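{- Let $\mathcal{D}\colon\mathcal{H}^0\to\mathcal{H}^{\geq 2}$ be the drop 1 operator, let $\tau$ be the anti-automorphism of $\mathcal{H}=\mathbb{Z}\langle x,y\rangle$ interchanging $x$ and $y$, and let $\star$ be the product on $\mathcal{H}^{2,3}=\mathbb{Z}\langle z_2,z_3\rangle$ (all as defined in the context). Then for all $w_1,w_2\in\mathcal{H}^{2,3}$, \[ \mathcal{D}(w_1\tau(w_2))=w_1\star w_2 . \]
   Context: **Algebras.** $\mathcal{H}=\mathbb{Z}\langle x,y\rangle$ is the non-commutative polynomial ring over $\mathbb{Z}$ in two variables $x,y$. For each positive integer $k$ put $z_k=yx^{k-1}$. Define subrings $\mathcal{H}^{2,3}=\mathbb{Z}\langle z_2,z_3\rangle$, $\mathcal{H}^{\geq 2}=\mathbb{Z}\langle z_2,z_3,z_4,\dots\rangle$ and $\mathcal{H}^0=\mathbb{Z}+y\mathcal{H}x$, so $\mathcal{H}^{2,3}\subset\mathcal{H}^{\geq 2}\subset\mathcal{H}^0\subset\mathcal{H}$. A word in $\mathcal{H}^{2,3}$ is a (possibly empty) monomial in $z_2,z_3$. **The anti-automorphism $\tau$.** $\tau$ is the anti-automorphism of $\mathcal{H}$ (i.e. $\tau(uv)=\tau(v)\tau(u)$) with $\tau(x)=y$, $\tau(y)=x$. **The product $\star$.** $\star$ is the $\mathbb{Z}$-bilinear product on $\mathcal{H}^{2,3}$ defined inductively, for words $w,w'$ in $\mathcal{H}^{2,3}$, by - $w\star 1=1\star w=w$; - $wz_2\star w'=w\star w'z_2=(w\star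 w')z_2$; - $wz_3\star w'z_3=(w\star w'z_3)z_3+(wz_3\star w')z_3+(w\star w')z_2^3$. **The drop 1 operator $\mathcal{D}$.** Notation: let $t$ be a positive integer, $\boldsymbol{c}=(c_1,\dots,c_{2t})$ a tuple of positive integers, $S\subset\mathbb{Z}$. - $[n]=\{1,\dots,n\}$; $[2t]^1_{\boldsymbol{c}}=\{i\in[2t]\mid c_i=1\}$; $[2t]^{>1}_{\boldsymbol{c}}=\{i\in[2t]\mid c_i>1\}$. - $\mathcal{P}^{\mathrm{eo}}(S)$ is the set of $A\subset S$ such that for every integer $i$: $i\in A\cap2\mathbb{Z}\iff i+1\in A\setminus2\mathbb{Z}$. - $\mathcal{P}^{\mathrm{oe}}(S)$ is the set of $A\subset S$ such that for every integer $i$: $i\in A\setminus2\mathbb{Z}\iff i+1\in A\cap2\mathbb{Z}$. - $\mathcal{P}^{\neg\mathrm{eo}}(S)$ is the set of $A\subset S$ such that for every integer $i$: $i\in A\cap2\mathbb{Z}\implies i+1\notin A\setminus2\mathbb{Z}$. - $\mathcal{P}^{\neg\mathrm{oe}}(S)$ is the set of $A\subset S$ such that for every integer $i$: $i\in A\setminus2\mathbb{Z}\implies i+1\notin A\cap2\mathbb{Z}$. - For $A,B\subset[2t]$, write $[2t]\setminus A=\{i_1<\cdots<i_r\}$; then $\boldsymbol{c}_{(-A)}=(c_{i_1},\dots,c_{i_r})$ (the empty tuple $\varnothing$ if $A=[2t]$) and $\boldsymbol{c}_{(-A)}-\boldsymbol{\delta}_B=(c_{i_1}-\delta_{i_1\in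 B},\dots,c_{i_r}-\delta_{i_r\in B})$, where $\delta_{i\in B}=1$ if $i\in B$ and $0$ otherwise. $\mathcal{D}\colon\mathcal{H}^0\to\mathcal{H}^{\geq2}$ is the $\mathbb{Z}$-linear map determined on words as follows. Write $\mathfrak{D}(\boldsymbol{c})=\mathcal{D}(y^{c_1}x^{c_2}\cdots y^{c_{2t-1}}x^{c_{2t}})$. Set $\mathfrak{D}(\varnothing)=\mathcal{D}(1)=1$, and inductively \begin{align*} \mathfrak{D}(\boldsymbol{c})&=\sum_{\substack{A\in\mathcal{P}^{\mathrm{eo}}([2t]^1_{\boldsymbol{c}})\\ B\in\mathcal{P}^{\neg\mathrm{eo}}([2t]^{>1}_{\boldsymbol{c}})\\ \#A+\#B\geq1}}(-1)^{\#B-1}\,\mathfrak{D}(\boldsymbol{c}_{(-A)}-\boldsymbol{\delta}_B)\,x^{\#A+\#B}\\ &\quad+\sum_{\substack{A\in\mathcal{P}^{\mathrm{eo}}([2t]^1_{\boldsymbol{c}})\\ B\in\mathcal{P}^{\neg\mathrm{eo}}([2t]^{>1}_{\boldsymbol{c}})\\ \#A+\#B\geq2}}(-1)^{\#B-1}\,\mathfrak{D}(\boldsymbol{c}_{(-A)}-\boldsymbol{\delta}_B)\,z_{\#A+\#B}\\ &\quad+\sum_{\substack{A\in\mathcal{P}^{\mathrm{oe}}([2t]^1_{\boldsymbol{c}})\\ B\in\mathcal{P}^{\neg\mathrm{oe}}([2t]^{>1}_{\boldsymbol{c}})\\ \#A+\#B\geq2}}(-1)^{\#B}\,\mathfrak{D}(\boldsymbol{c}_{(-A)}-\boldsymbol{\delta}_B)\,z_{\#A+\#B}.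 \end{align*} -}

module Defs where

open import Data.Bool.Base as Bool using (if_then_else_)
open import Data.Empty using (⊥-elim)
open import Data.Fin.Base as Fin using (Fin; toℕ)
open import Data.Fin.Properties using (any?; toℕ<n)
open import Data.Fin.Subset using (Subset; inside; outside; _∈_; _⊆_; ∣_∣)
open import Data.Fin.Subset.Properties using (_∈?_; _⊆?_; drop-∷-⊆)
open import Data.Integer.Base as ℤ using (ℤ; +_; -[1+_]; 0ℤ; 1ℤ; -1ℤ)
import Data.Integer.Properties as ℤ
open import Data.Integer.Divisibility using (_∣_)
open import Data.List.Base
  using (List; []; _∷_; _++_; _∷ʳ_; [_]; length; map; concatMap; replicate; reverse; filter; cartesianProduct)
import Data.List.Properties as List
open import Data.List.Membership.Propositional using () renaming (_∈_ to _∈ˡ_)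
open import Data.List.Membership.Propositional.Properties using (∈-filter⁻; ∈-cartesianProduct⁻)
open import Data.List.Relation.Unary.All as All using (All; []; _∷_)
import Data.List.Relation.Unary.All.Properties as All
open import Data.List.Relation.Unary.Any using (here; there)
open import Data.List.Reverse using (Reverse; []; _∶_∶ʳ_; reverseView)
open import Data.Nat.Base as ℕ using (ℕ; zero; suc; _∸_; _≤_; _<_; z≤n; s≤s)
import Data.Nat.Divisibility as ℕ
open import Data.Nat.ListAction using (sum)
import Data.Nat.Properties as ℕ
open import Data.Product.Base using (Σ; ∃; ∃₂; _×_; _,_; proj₁; proj₂; map₁; map₂)
open import Data.Sum.Base using (_⊎_; inj₁; inj₂)
open import Data.Vec.Base as Vec using ([]; _∷_; here)
open import Function.Base using (_∘_; const)
open import Function.Bundles using (_⇔_; mk⇔; Equivalence)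
open import Relation.Binary.Definitions using (DecidableEquality)
open import Relation.Binary.PropositionalEquality
  using (_≡_; _≢_; refl; sym; trans; cong; cong₂; subst; module ≡-Reasoning)
open import Relation.Nullary using (¬_; Dec; yes; no; does)
open import Relation.Nullary.Decidable using (map′; _×-dec_; _→-dec_; ¬?)

-- ℤ⟨ X ⟩ is the free associative ring on X.  An element is a formal finite sum
-- of terms (coefficient , word); terms need not be collected, so two such sums
-- denote the same element exactly when all their coefficients agree (_≈_ below).

ℤ⟨_⟩ : Set → Set
ℤ⟨ X ⟩ = List (ℤ × List X)

module _ {X : Set} where

  ⟦_⟧ : List X → ℤ⟨ X ⟩
  ⟦ w ⟧ = [ (1ℤ , w) ]

  const⟨_⟩ : ℤ → ℤ⟨ X ⟩
  const⟨ n ⟩ = [ (n , []) ]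

  infixl 6 _+_
  _+_ : ℤ⟨ X ⟩ → ℤ⟨ X ⟩ → ℤ⟨ X ⟩
  _+_ = _++_

  infixr 8 _·_
  _·_ : ℤ → ℤ⟨ X ⟩ → ℤ⟨ X ⟩
  a · p = map (map₁ (a ℤ.*_)) p

  ∑ : {I : Set} → List I → (I → ℤ⟨ X ⟩) → ℤ⟨ X ⟩
  ∑ is f = concatMap f is

linear : {X Y : Set} → (List X → ℤ⟨ Y ⟩) → ℤ⟨ X ⟩ → ℤ⟨ Y ⟩
linear f p = ∑ p λ (a , w) → a · f w

infixl 7 _*_
_*_ : {X : Set} → ℤ⟨ X ⟩ → ℤ⟨ X ⟩ → ℤ⟨ X ⟩
p * q = linear (λ u → linear (λ v → ⟦ u ++ v ⟧) q) p

data Letter : Set where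
  x y : Letter

_≟ᴸ_ : DecidableEquality Letter
x ≟ᴸ x = yes refl
x ≟ᴸ y = no λ ()
y ≟ᴸ x = no λ ()
y ≟ᴸ y = yes refl

Word : Set
Word = List Letter

ℋ : Set
ℋ = ℤ⟨ Letter ⟩

coeff : ℋ → Word → ℤ
coeff []            w = 0ℤ
coeff ((a , u) ∷ p) w =
  (if does (List.≡-dec _≟ᴸ_ u w) then a else 0ℤ) ℤ.+ coeff p w

infix 4 _≈_
_≈_ : ℋ → ℋ → Set
p ≈ q = ∀ w → coeff p w ≡ coeff q w

swap : Letter → Letter
swap x = y
swap y = x

τ : ℋ → ℋ
τ = linear λ w → ⟦ reverse (map swap w) ⟧

-- Only used for k ≥ 1.
z : ℕ → Word
z k = y ∷ replicate (k ∸ 1) x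

data Gen : Set where
  z₂ z₃ : Gen

ℋ²³ : Set
ℋ²³ = ℤ⟨ Gen ⟩

genWord : Gen → Word
genWord z₂ = z 2
genWord z₃ = z 3

-- The inclusion ℋ²³ ⊂ ℋ; it identifies ℤ⟨z₂,z₃⟩ with a subring of ℋ because
-- {yx , yxx} is a code.
ι : ℋ²³ → ℋ
ι = linear λ w → ⟦ concatMap genWord w ⟧

-- w ⋆ w′ for words in z₂, z₃, read from the right.  When both words end in z₂
-- the letter is taken off the left factor; ⋆-z₂ʳ shows that taking it off the
-- right factor gives the same result.
⋆ʳ : {w w′ : List Gen} → Reverse w → Reverse w′ → ℋ²³
⋆ʳ {w′ = w′} []             _               = ⟦ w′ ⟧
⋆ʳ {w = w}   (_ ∶ _ ∶ʳ _)   []              = ⟦ w ⟧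
⋆ʳ (_ ∶ r ∶ʳ z₂)            r′@(_ ∶ _ ∶ʳ _) = ⋆ʳ r r′ * ⟦ [ z₂ ] ⟧
⋆ʳ r@(_ ∶ _ ∶ʳ z₃)          (_ ∶ r′ ∶ʳ z₂)  = ⋆ʳ r r′ * ⟦ [ z₂ ] ⟧
⋆ʳ r₃@(_ ∶ r ∶ʳ z₃)         r′₃@(_ ∶ r′ ∶ʳ z₃) =
    ⋆ʳ r  r′₃ * ⟦ [ z₃ ] ⟧
  + ⋆ʳ r₃ r′  * ⟦ [ z₃ ] ⟧
  + ⋆ʳ r  r′  * ⟦ z₂ ∷ z₂ ∷ z₂ ∷ [] ⟧

_⋆ʷ_ : List Gen → List Gen → ℋ²³
w ⋆ʷ w′ = ⋆ʳ (reverseView w) (reverseView w′)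

infixl 7 _⋆_
_⋆_ : ℋ²³ → ℋ²³ → ℋ²³
p ⋆ q = linear (λ u → linear (λ v → u ⋆ʷ v) q) p

private
  ∷ʳ≢[] : {X : Set} (xs : List X) {a : X} → xs ∷ʳ a ≢ []
  ∷ʳ≢[] []      ()
  ∷ʳ≢[] (_ ∷ _) ()

  Reverse-unique : {X : Set} {xs ys : List X} (r : Reverse xs) (s : Reverse ys) (eq : xs ≡ ys) →
                   subst Reverse eq r ≡ s
  Reverse-unique [] [] refl = refl
  Reverse-unique [] (ys ∶ _ ∶ʳ _) eq = ⊥-elim (∷ʳ≢[] ys (sym eq))
  Reverse-unique (xs ∶ _ ∶ʳ _) [] eq = ⊥-elim (∷ʳ≢[] xs eq)
  Reverse-unique (xs ∶ r ∶ʳ a) (ys ∶ s ∶ʳ b) eq with List.∷ʳ-injective xs ys eq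
  Reverse-unique (xs ∶ r ∶ʳ a) (xs ∶ s ∶ʳ a) refl | refl , refl =
    cong (λ t → xs ∶ t ∶ʳ a) (Reverse-unique r s refl)

  view-∷ʳ : {X : Set} (xs : List X) (a : X) → reverseView (xs ∷ʳ a) ≡ xs ∶ reverseView xs ∶ʳ a
  view-∷ʳ xs a = Reverse-unique _ _ refl

⋆-identityˡ : ∀ w → [] ⋆ʷ w ≡ ⟦ w ⟧
⋆-identityˡ w = refl

⋆-identityʳ : ∀ w → w ⋆ʷ [] ≡ ⟦ w ⟧
⋆-identityʳ w with reverseView w
... | []         = refl
... | _ ∶ _ ∶ʳ _ = refl

private
  ⋆ʳ-z₂ˡ : ∀ {w w′} (r : Reverse w) (r′ : Reverse w′) →
           ⋆ʳ (w ∶ r ∶ʳ z₂) r′ ≡ ⋆ʳ r r′ * ⟦ [ z₂ ] ⟧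
  ⋆ʳ-z₂ˡ []           []           = refl
  ⋆ʳ-z₂ˡ (_ ∶ _ ∶ʳ _) []           = refl
  ⋆ʳ-z₂ˡ r            (_ ∶ _ ∶ʳ _) = refl

  ⋆ʳ-z₂ʳ : ∀ {w w′} (r : Reverse w) (r′ : Reverse w′) →
           ⋆ʳ r (w′ ∶ r′ ∶ʳ z₂) ≡ ⋆ʳ r r′ * ⟦ [ z₂ ] ⟧
  ⋆ʳ-z₂ʳ []             r′ = refl
  ⋆ʳ-z₂ʳ (_ ∶ r ∶ʳ z₂) r′ =
    cong (_* ⟦ [ z₂ ] ⟧) (trans (⋆ʳ-z₂ʳ r r′) (sym (⋆ʳ-z₂ˡ r r′)))
  ⋆ʳ-z₂ʳ (_ ∶ r ∶ʳ z₃) r′ = refl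

⋆-z₂ˡ : ∀ w w′ → (w ∷ʳ z₂) ⋆ʷ w′ ≡ (w ⋆ʷ w′) * ⟦ [ z₂ ] ⟧
⋆-z₂ˡ w w′ rewrite view-∷ʳ w z₂ = ⋆ʳ-z₂ˡ (reverseView w) (reverseView w′)

⋆-z₂ʳ : ∀ w w′ → w ⋆ʷ (w′ ∷ʳ z₂) ≡ (w ⋆ʷ w′) * ⟦ [ z₂ ] ⟧
⋆-z₂ʳ w w′ rewrite view-∷ʳ w′ z₂ = ⋆ʳ-z₂ʳ (reverseView w) (reverseView w′)

⋆-z₃ : ∀ w w′ → (w ∷ʳ z₃) ⋆ʷ (w′ ∷ʳ z₃) ≡
         (w ⋆ʷ (w′ ∷ʳ z₃)) * ⟦ [ z₃ ] ⟧
       + ((w ∷ʳ z₃) ⋆ʷ w′) * ⟦ [ z₃ ] ⟧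
       + (w ⋆ʷ w′) * ⟦ z₂ ∷ z₂ ∷ z₂ ∷ [] ⟧
⋆-z₃ w w′ rewrite view-∷ʳ w z₃ | view-∷ʳ w′ z₃ = refl

-- ℋ⁰ = ℤ + yℋx

infix 4 _∈ℋ⁰
_∈ℋ⁰ : ℋ → Set
p ∈ℋ⁰ = ∃₂ λ (n : ℤ) (q : ℋ) → p ≈ const⟨ n ⟩ + ⟦ [ y ] ⟧ * q * ⟦ [ x ] ⟧

ℋ⁰ : Set
ℋ⁰ = Σ ℋ _∈ℋ⁰

-- Subsets of [n] = {1,…,n} are represented as Subset n; since Fin n starts at
-- 0, the element j : Fin n stands for the integer 1 + toℕ j.

infix 4 _∋_
_∋_ : ∀ {n} → Subset n → ℤ → Set
A ∋ i = ∃ λ j → j ∈ A × + suc (toℕ j) ≡ i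

infix 4 _∈_∩2ℤ _∈_∖2ℤ
_∈_∩2ℤ _∈_∖2ℤ : ∀ {n} → ℤ → Subset n → Set
i ∈ A ∩2ℤ = A ∋ i × + 2 ∣ i
i ∈ A ∖2ℤ = A ∋ i × ¬ (+ 2 ∣ i)

eo oe ¬eo ¬oe : ∀ {n} → Subset n → Set
eo  A = ∀ (i : ℤ) → i ∈ A ∩2ℤ ⇔ i ℤ.+ 1ℤ ∈ A ∖2ℤ
oe  A = ∀ (i : ℤ) → i ∈ A ∖2ℤ ⇔ i ℤ.+ 1ℤ ∈ A ∩2ℤ
¬eo A = ∀ (i : ℤ) → i ∈ A ∩2ℤ → ¬ (i ℤ.+ 1ℤ ∈ A ∖2ℤ)
¬oe A = ∀ (i : ℤ) → i ∈ A ∖2ℤ → ¬ (i ℤ.+ 1ℤ ∈ A ∩2ℤ)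

private
  ∀ℤ? : {P : ℤ → Set} → (∀ i → Dec (P i)) → ∀ n →
        (∀ k → P -[1+ k ]) → (∀ k → n < k → P (+ k)) → Dec (∀ i → P i)
  ∀ℤ? {P} P? n neg big =
    map′ all (λ f {k} _ → f (+ k)) (ℕ.allUpTo? (λ k → P? (+ k)) (suc n))
    where
    all : (∀ {k} → k < suc n → P (+ k)) → ∀ i → P i
    all f -[1+ k ] = neg k
    all f (+ k) with k ℕ.≤? n
    ... | yes k≤n = f (s≤s k≤n)
    ... | no  k≰n = big k (ℕ.≰⇒> k≰n)

  _⇔?_ : {P Q : Set} → Dec P → Dec Q → Dec (P ⇔ Q)
  P? ⇔? Q? = map′ (λ (f , g) → mk⇔ f g) (λ e → Equivalence.to e , Equivalence.from e)
                  ((P? →-dec Q?) ×-dec (Q? →-dec P?))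

  module _ {n} (A : Subset n) where

    ∋? : ∀ i → Dec (A ∋ i)
    ∋? i = any? λ j → (j ∈? A) ×-dec (+ suc (toℕ j) ℤ.≟ i)

    2∣? : ∀ i → Dec (+ 2 ∣ i)
    2∣? i = 2 ℕ.∣? ℤ.∣ i ∣

    ∩? : ∀ i → Dec (i ∈ A ∩2ℤ)
    ∩? i = ∋? i ×-dec 2∣? i

    ∖? : ∀ i → Dec (i ∈ A ∖2ℤ)
    ∖? i = ∋? i ×-dec ¬? (2∣? i)

    ∌-neg : ∀ k → ¬ (A ∋ -[1+ k ])
    ∌-neg k (_ , _ , ())

    ∌-neg+1 : ∀ k → ¬ (A ∋ -[1+ k ] ℤ.+ 1ℤ)
    ∌-neg+1 zero    (_ , _ , ())
    ∌-neg+1 (suc k) (_ , _ , ())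

    ∌-big : ∀ k → n < k → ¬ (A ∋ + k)
    ∌-big k n<k (j , _ , refl) = ℕ.<⇒≱ n<k (toℕ<n j)

    ∌-big+1 : ∀ k → n < k → ¬ (A ∋ + k ℤ.+ 1ℤ)
    ∌-big+1 k n<k = ∌-big (k ℕ.+ 1) (ℕ.≤-trans n<k (ℕ.m≤m+n k 1))

    vacuous : {P Q : ℤ → Set} → ∀ {i i′} → ¬ (A ∋ i) → ¬ (A ∋ i′) →
              (A ∋ i × P i) ⇔ (A ∋ i′ × Q i′)
    vacuous i∉ i′∉ = mk⇔ (⊥-elim ∘ i∉ ∘ proj₁) (⊥-elim ∘ i′∉ ∘ proj₁)

eo? : ∀ {n} (A : Subset n) → Dec (eo A)
eo? {n} A = ∀ℤ? (λ i → ∩? A i ⇔? ∖? A (i ℤ.+ 1ℤ)) n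
  (λ k     → vacuous A {P = + 2 ∣_} {¬_ ∘ (+ 2 ∣_)} (∌-neg A k) (∌-neg+1 A k))
  (λ k n<k → vacuous A {P = + 2 ∣_} {¬_ ∘ (+ 2 ∣_)} (∌-big A k n<k) (∌-big+1 A k n<k))

oe? : ∀ {n} (A : Subset n) → Dec (oe A)
oe? {n} A = ∀ℤ? (λ i → ∖? A i ⇔? ∩? A (i ℤ.+ 1ℤ)) n
  (λ k     → vacuous A {P = ¬_ ∘ (+ 2 ∣_)} {+ 2 ∣_} (∌-neg A k) (∌-neg+1 A k))
  (λ k n<k → vacuous A {P = ¬_ ∘ (+ 2 ∣_)} {+ 2 ∣_} (∌-big A k n<k) (∌-big+1 A k n<k))

¬eo? : ∀ {n} (A : Subset n) → Dec (¬eo A)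
¬eo? {n} A = ∀ℤ? (λ i → ∩? A i →-dec ¬? (∖? A (i ℤ.+ 1ℤ))) n
  (λ k     → ⊥-elim ∘ ∌-neg A k ∘ proj₁)
  (λ k n<k → ⊥-elim ∘ ∌-big A k n<k ∘ proj₁)

¬oe? : ∀ {n} (A : Subset n) → Dec (¬oe A)
¬oe? {n} A = ∀ℤ? (λ i → ∖? A i →-dec ¬? (∩? A (i ℤ.+ 1ℤ))) n
  (λ k     → ⊥-elim ∘ ∌-neg A k ∘ proj₁)
  (λ k n<k → ⊥-elim ∘ ∌-big A k n<k ∘ proj₁)

allSubsets : ∀ n → List (Subset n)
allSubsets zero    = [ [] ]
allSubsets (suc n) = map (outside ∷_) (allSubsets n) ++ map (inside ∷_) (allSubsets n)

𝒫 : ∀ {n} {Q : Subset n → Set} → (∀ A → Dec (Q A)) → Subset n → List (Subset n)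
𝒫 Q? S = filter (λ A → (A ⊆? S) ×-dec Q? A) (allSubsets _)

ones larges : (c : List ℕ) → Subset (length c)
ones   c = Vec.map (λ cᵢ → does (cᵢ ℕ.≟ 1)) (Vec.fromList c)
larges c = Vec.map (λ cᵢ → does (1 ℕ.<? cᵢ)) (Vec.fromList c)

-- c₍₋A₎ − δ_B
infix 5 _₍₋_₎−δ_
_₍₋_₎−δ_ : (c : List ℕ) (A B : Subset (length c)) → List ℕ
[]      ₍₋ []          ₎−δ []            = []
(_ ∷ c) ₍₋ inside  ∷ A ₎−δ (_       ∷ B) = c ₍₋ A ₎−δ B
(a ∷ c) ₍₋ outside ∷ A ₎−δ (inside  ∷ B) = (a ∸ 1) ∷ (c ₍₋ A ₎−δ B)
(a ∷ c) ₍₋ outside ∷ A ₎−δ (outside ∷ B) = a ∷ (c ₍₋ A ₎−δ B)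

pairs : ∀ {n} → ℕ → List (Subset n) → List (Subset n) → List (Subset n × Subset n)
pairs k 𝒜 ℬ = filter (λ (A , B) → k ℕ.≤? ∣ A ∣ ℕ.+ ∣ B ∣) (cartesianProduct 𝒜 ℬ)

-- The right-hand side of the recursion for 𝔇, with F in place of 𝔇.  The sign
-- (-1)^(#B-1) is written (-1)^(#B+1), since #B may be 0.
step : (List ℕ → ℋ) → List ℕ → ℋ
step F c =
    ∑ (pairs 1 (𝒫 eo? (ones c)) (𝒫 ¬eo? (larges c)))
      (λ (A , B) → (-1ℤ ℤ.^ suc ∣ B ∣) · (F (c ₍₋ A ₎−δ B) * ⟦ replicate (∣ A ∣ ℕ.+ ∣ B ∣) x ⟧))
  + ∑ (pairs 2 (𝒫 eo? (ones c)) (𝒫 ¬eo? (larges c)))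
      (λ (A , B) → (-1ℤ ℤ.^ suc ∣ B ∣) · (F (c ₍₋ A ₎−δ B) * ⟦ z (∣ A ∣ ℕ.+ ∣ B ∣) ⟧))
  + ∑ (pairs 2 (𝒫 oe? (ones c)) (𝒫 ¬oe? (larges c)))
      (λ (A , B) → (-1ℤ ℤ.^ ∣ B ∣) · (F (c ₍₋ A ₎−δ B) * ⟦ z (∣ A ∣ ℕ.+ ∣ B ∣) ⟧))

-- The entries of c₍₋A₎ − δ_B add up to #A + #B less than those of c, so sum c
-- levels of recursion suffice; 𝔇-rec is the recursion without the counter.
-- The combinatorial meaning is for lists of positive integers of even length.
𝔇-upTo : ℕ → List ℕ → ℋ
𝔇-upTo _       []        = ⟦ [] ⟧
𝔇-upTo zero    (_ ∷ _)   = []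
𝔇-upTo (suc n) c@(_ ∷ _) = step (𝔇-upTo n) c

𝔇 : List ℕ → ℋ
𝔇 c = 𝔇-upTo (sum c) c

Positive : List ℕ → Set
Positive = All (1 ≤_)

private
  Words : {X : Set} → (List X → Set) → ℤ⟨ X ⟩ → Set
  Words Q = All (Q ∘ proj₂)

  Words-· : {X : Set} {Q : List X → Set} → ∀ a {p} → Words Q p → Words Q (a · p)
  Words-· a []         = []
  Words-· a (qw ∷ qws) = qw ∷ Words-· a qws

  Words-∑ : {X I : Set} {Q : List X → Set} (is : List I) (f : I → ℤ⟨ X ⟩) →
            (∀ i → i ∈ˡ is → Words Q (f i)) → Words Q (∑ is f)
  Words-∑ []       f h = []
  Words-∑ (i ∷ is) f h = All.++⁺ (h i (here refl)) (Words-∑ is f (λ j j∈ → h j (there j∈)))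

  Words-linear : {X Y : Set} {P : List X → Set} {Q : List Y → Set} {f : List X → ℤ⟨ Y ⟩} →
                 (∀ w → P w → Words Q (f w)) → ∀ {p} → Words P p → Words Q (linear f p)
  Words-linear h []                          = []
  Words-linear h {(a , w) ∷ _} (pw ∷ pws) = All.++⁺ (Words-· a (h w pw)) (Words-linear h pws)

  Words-⟦⟧ : {X : Set} {Q : List X → Set} {w : List X} → Q w → Words Q ⟦ w ⟧
  Words-⟦⟧ qw = qw ∷ []

  Words-* : {X : Set} {P Q R : List X → Set} → (∀ u v → P u → Q v → R (u ++ v)) →
            ∀ {p q} → Words P p → Words Q q → Words R (p * q)
  Words-* {Q = Q} {R} h {q = q} Pp Qq = Words-linear {Q = R} {f = λ u → linear (λ v → ⟦ u ++ v ⟧) q}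
    (λ u Pu → Words-linear {P = Q} {R} {λ v → ⟦ u ++ v ⟧} (λ v Qv → Words-⟦⟧ (h u v Pu Qv)) Qq) Pp

  ∑-cong : {X I : Set} (is : List I) {f g : I → ℤ⟨ X ⟩} →
           (∀ i → i ∈ˡ is → f i ≡ g i) → ∑ is f ≡ ∑ is g
  ∑-cong []       h = refl
  ∑-cong (i ∷ is) h = cong₂ _++_ (h i (here refl)) (∑-cong is (λ j j∈ → h j (there j∈)))

  ∈-pairs⁻ : ∀ {n} k {P Q : Subset n → Set} (P? : ∀ A → Dec (P A)) (Q? : ∀ A → Dec (Q A)) {S T : Subset n}
             {A B : Subset n} → (A , B) ∈ˡ pairs k (𝒫 P? S) (𝒫 Q? T) →
             (A ⊆ S × P A) × (B ⊆ T × Q B) × k ≤ ∣ A ∣ ℕ.+ ∣ B ∣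
  ∈-pairs⁻ k P? Q? {S} {T} AB∈
    with AB∈× , k≤ ← ∈-filter⁻ (λ (A , B) → k ℕ.≤? ∣ A ∣ ℕ.+ ∣ B ∣) AB∈
    with A∈ , B∈ ← ∈-cartesianProduct⁻ (𝒫 P? S) (𝒫 Q? T) AB∈×
    = proj₂ (∈-filter⁻ (λ A → (A ⊆? S) ×-dec P? A) {xs = allSubsets _} A∈)
    , proj₂ (∈-filter⁻ (λ A → (A ⊆? T) ×-dec Q? A) {xs = allSubsets _} B∈) , k≤

  zero∈⇒T : ∀ {n b} {S : Subset n} → Fin.zero ∈ (b ∷ S) → Bool.T b
  zero∈⇒T here = _

  at-one : ∀ {a n} {S : Subset n} → Fin.zero ∈ (does (a ℕ.≟ 1) ∷ S) → a ≡ 1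
  at-one {a} h = ℕ.≡ᵇ⇒≡ a 1 (zero∈⇒T h)

  at-large : ∀ {a n} {S : Subset n} → Fin.zero ∈ (does (1 ℕ.<? a) ∷ S) → 1 < a
  at-large {a} h = ℕ.≤ᵇ⇒≤ 2 a (zero∈⇒T h)

  -δ-weight : ∀ c (A B : Subset (length c)) → A ⊆ ones c → B ⊆ larges c → Positive c →
              Positive (c ₍₋ A ₎−δ B) × sum (c ₍₋ A ₎−δ B) ℕ.+ (∣ A ∣ ℕ.+ ∣ B ∣) ≡ sum c
  -δ-weight [] [] [] _ _ _ = [] , refl
  -δ-weight (a ∷ c) (s ∷ A) (t ∷ B) A⊆ B⊆ (1≤a ∷ pos)
    with pos′ , eq ← -δ-weight c A B (drop-∷-⊆ A⊆) (drop-∷-⊆ B⊆) pos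
    with s | t
  ... | inside  | inside  = ⊥-elim (ℕ.<-irrefl (sym (at-one {a} (A⊆ here))) (at-large {a} (B⊆ here)))
  ... | inside  | outside rewrite at-one {a} (A⊆ here) =
    pos′ , trans (ℕ.+-suc (sum (c ₍₋ A ₎−δ B)) _) (cong suc eq)
  ... | outside | outside = 1≤a ∷ pos′ , trans (ℕ.+-assoc a _ _) (cong (a ℕ.+_) eq)
  ... | outside | inside with s≤s (s≤s {n = b} z≤n) ← at-large {a} (B⊆ here) = s≤s z≤n ∷ pos′ , (begin
    suc b ℕ.+ σ ℕ.+ (∣ A ∣ ℕ.+ suc ∣ B ∣)    ≡⟨ cong (suc b ℕ.+ σ ℕ.+_) (ℕ.+-suc ∣ A ∣ ∣ B ∣) ⟩
    suc b ℕ.+ σ ℕ.+ suc (∣ A ∣ ℕ.+ ∣ B ∣)    ≡⟨ ℕ.+-suc (suc b ℕ.+ σ) _ ⟩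
    suc (suc b) ℕ.+ σ ℕ.+ (∣ A ∣ ℕ.+ ∣ B ∣)  ≡⟨ ℕ.+-assoc (suc (suc b)) σ _ ⟩
    suc (suc b) ℕ.+ (σ ℕ.+ (∣ A ∣ ℕ.+ ∣ B ∣)) ≡⟨ cong (suc (suc b) ℕ.+_) eq ⟩
    suc (suc b) ℕ.+ sum c                    ∎)
    where open ≡-Reasoning
          σ = sum (c ₍₋ A ₎−δ B)

  step-cong : ∀ {F G} c → Positive c →
              (∀ c′ → Positive c′ → sum c′ < sum c → F c′ ≡ G c′) → step F c ≡ step G c
  step-cong {F} {G} c pos h =
    cong₂ _++_ (cong₂ _++_
      (∑-cong (pairs 1 (𝒫 eo? _) (𝒫 ¬eo? _)) 
        (λ (A , B) → part 1 eo? ¬eo? (s≤s z≤n) A B (-1ℤ ℤ.^ suc ∣ B ∣) (replicate (∣ A ∣ ℕ.+ ∣ B ∣) x)))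
      (∑-cong (pairs 2 (𝒫 eo? _) (𝒫 ¬eo? _)) 
        (λ (A , B) → part 2 eo? ¬eo? (s≤s z≤n) A B (-1ℤ ℤ.^ suc ∣ B ∣) (z (∣ A ∣ ℕ.+ ∣ B ∣)))))
      (∑-cong (pairs 2 (𝒫 oe? _) (𝒫 ¬oe? _)) 
        (λ (A , B) → part 2 oe? ¬oe? (s≤s z≤n) A B (-1ℤ ℤ.^ ∣ B ∣) (z (∣ A ∣ ℕ.+ ∣ B ∣))))
    where
    part : ∀ k {P Q : Subset (length c) → Set} (P? : ∀ A → Dec (P A)) (Q? : ∀ A → Dec (Q A)) → 1 ≤ k →
           ∀ A B a w → (A , B) ∈ˡ pairs k (𝒫 P? (ones c)) (𝒫 Q? (larges c)) →
           a · (F (c ₍₋ A ₎−δ B) * ⟦ w ⟧) ≡ a · (G (c ₍₋ A ₎−δ B) * ⟦ w ⟧)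
    part k P? Q? 1≤k A B a w AB∈
      with (A⊆ , _) , (B⊆ , _) , k≤ ← ∈-pairs⁻ k P? Q? AB∈
      with pos′ , eq ← -δ-weight c A B A⊆ B⊆ pos
      = cong (λ p → a · (p * ⟦ w ⟧))
          (h _ pos′ (subst (sum (c ₍₋ A ₎−δ B) <_) eq (ℕ.m<m+n _ (ℕ.≤-trans 1≤k k≤))))

  𝔇-stable : ∀ m n c → Positive c → sum c ≤ m → sum c ≤ n → 𝔇-upTo m c ≡ 𝔇-upTo n c
  𝔇-stable m       n       []      _   _ _ = refl
  𝔇-stable zero    n       (a ∷ c) (1≤a ∷ _) s _ = ⊥-elim (ℕ.<⇒≱ 1≤a (ℕ.≤-trans (ℕ.m≤m+n a _) s))
  𝔇-stable (suc m) zero    (a ∷ c) (1≤a ∷ _) _ s = ⊥-elim (ℕ.<⇒≱ 1≤a (ℕ.≤-trans (ℕ.m≤m+n a _) s))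
  𝔇-stable (suc m) (suc n) c@(_ ∷ _) pos sm sn = step-cong c pos λ c′ pos′ lt →
    𝔇-stable m n c′ pos′ (ℕ.≤-pred (ℕ.≤-trans lt sm)) (ℕ.≤-pred (ℕ.≤-trans lt sn))

𝔇-rec : ∀ c → Positive c → c ≢ [] → 𝔇 c ≡ step 𝔇 c
𝔇-rec [] _ c≢[] = ⊥-elim (c≢[] refl)
𝔇-rec c@(a ∷ c₀) pos@(1≤a ∷ _) _ = trans
  (𝔇-stable (sum c) (suc (sum c)) c pos ℕ.≤-refl (ℕ.n≤1+n _))
  (step-cong c pos λ c′ pos′ lt → 𝔇-stable (sum c) (sum c′) c′ pos′ (ℕ.<⇒≤ lt) ℕ.≤-refl)

incHead : List ℕ → List ℕ
incHead []      = []
incHead (a ∷ c) = suc a ∷ c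

-- The lengths of the maximal blocks of equal letters; exponents-powers shows
-- that y^c₁ x^c₂ ⋯ y^c₂ₜ₋₁ x^c₂ₜ is sent to (c₁ , … , c₂ₜ).
exponents : Word → List ℕ
exponents []          = []
exponents (_ ∷ [])    = [ 1 ]
exponents (a ∷ b ∷ w) =
  if does (a ≟ᴸ b) then incHead (exponents (b ∷ w)) else 1 ∷ exponents (b ∷ w)

powers : Letter → List ℕ → Word
powers a []      = []
powers a (k ∷ c) = replicate k a ++ powers (swap a) c

exponents-powers : ∀ a c → Positive c → exponents (powers a c) ≡ c
exponents-powers a []           _                 = refl
exponents-powers a (zero  ∷ c)  (() ∷ _)
exponents-powers a (suc k ∷ c)  (_ ∷ pos)         = block a k c pos (exponents-powers (swap a) c pos)
  where
  same : ∀ a w → exponents (a ∷ a ∷ w) ≡ incHead (exponents (a ∷ w))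
  same x w = refl
  same y w = refl

  change : ∀ a w → exponents (a ∷ swap a ∷ w) ≡ 1 ∷ exponents (swap a ∷ w)
  change x w = refl
  change y w = refl

  block : ∀ a k c → Positive c → exponents (powers (swap a) c) ≡ c →
          exponents (powers a (suc k ∷ c)) ≡ suc k ∷ c
  block a zero    []          _        _  = refl
  block a zero    (zero  ∷ c) (() ∷ _) _
  block a zero    (suc m ∷ c) _        eq = trans (change a (replicate m (swap a) ++ powers (swap (swap a)) c)) (cong (1 ∷_) eq)
  block a (suc k) c           pos      eq = trans (same a (replicate k a ++ powers (swap a) c)) (cong incHead (block a k c pos eq))

-- ℋ^{≥2} = ℤ⟨z₂,z₃,z₄,…⟩; the generator k of ℤ⟨ ℕ ⟩ stands for z₂₊ₖ.

zWord : List ℕ → Word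
zWord = concatMap λ k → z (2 ℕ.+ k)

infix 4 _∈ℋ≥²
_∈ℋ≥² : ℋ → Set
p ∈ℋ≥² = ∃ λ (q : ℤ⟨ ℕ ⟩) → p ≈ linear (λ ks → ⟦ zWord ks ⟧) q

ℋ≥² : Set
ℋ≥² = Σ ℋ _∈ℋ≥²

private
  IsZWord NonEmptyZWord : Word → Set
  IsZWord       w = ∃ λ ks → w ≡ zWord ks
  NonEmptyZWord w = ∃₂ λ k ks → w ≡ zWord (k ∷ ks)

  weaken : ∀ {w} → NonEmptyZWord w → IsZWord w
  weaken (k , ks , eq) = k ∷ ks , eq

  replicate-+ : ∀ m n → replicate m x ++ replicate n x ≡ replicate (m ℕ.+ n) x
  replicate-+ zero    n = refl
  replicate-+ (suc m) n = cong (x ∷_) (replicate-+ m n)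

  zs++xs : ∀ m k ks → NonEmptyZWord (zWord (k ∷ ks) ++ replicate m x)
  zs++xs m k [] = k ℕ.+ m , [] , (begin
    (z (2 ℕ.+ k) ++ []) ++ replicate m x  ≡⟨ cong (_++ replicate m x) (List.++-identityʳ (z (2 ℕ.+ k))) ⟩
    z (2 ℕ.+ k) ++ replicate m x          ≡⟨ cong (λ w → y ∷ x ∷ w) (replicate-+ k m) ⟩
    z (2 ℕ.+ (k ℕ.+ m))                   ≡⟨ List.++-identityʳ (z (2 ℕ.+ (k ℕ.+ m))) ⟨
    z (2 ℕ.+ (k ℕ.+ m)) ++ []             ∎)
    where open ≡-Reasoning
  zs++xs m k (k′ ∷ ks) with l , ls , eq ← zs++xs m k′ ks =
    k , l ∷ ls , trans (List.++-assoc (z (2 ℕ.+ k)) (zWord (k′ ∷ ks)) _) (cong (z (2 ℕ.+ k) ++_) eq)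

  ++-x : ∀ m w → NonEmptyZWord w → NonEmptyZWord (w ++ replicate m x)
  ++-x m _ (k , ks , refl) = zs++xs m k ks

  zs++z : ∀ m ks → NonEmptyZWord (zWord ks ++ z (2 ℕ.+ m))
  zs++z m []       = m , [] , sym (List.++-identityʳ (z (2 ℕ.+ m)))
  zs++z m (k ∷ ks) with l , ls , eq ← zs++z m ks =
    k , l ∷ ls , trans (List.++-assoc (z (2 ℕ.+ k)) (zWord ks) _) (cong (z (2 ℕ.+ k) ++_) eq)

  ++-z : ∀ m w → 2 ≤ m → IsZWord w → NonEmptyZWord (w ++ z m)
  ++-z _ _ (s≤s (s≤s {n = m} z≤n)) (ks , refl) = zs++z m ks

  1∉eo : ∀ {n} (A : Subset n) → eo (inside ∷ A) → ∀ {ℓ} {P : Set ℓ} → P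
  1∉eo A eoA with Equivalence.from (eoA 0ℤ) ((Fin.zero , here , refl) , λ 2∣1 → ℕ.<⇒≱ (s≤s (s≤s z≤n)) (ℕ.∣⇒≤ 2∣1))
  ... | (_ , _ , ()) , _

  𝔇-words : ∀ n c → Words IsZWord (𝔇-upTo n c) × (c ≢ [] → Words NonEmptyZWord (𝔇-upTo n c))
  𝔇-words n       []        = ([] , refl) ∷ [] , λ c≢[] → ⊥-elim (c≢[] refl)
  𝔇-words zero    (_ ∷ _)   = [] , λ _ → []
  𝔇-words (suc n) c@(a ∷ c₀) = All.map weaken all , const all
    where
    nonEmpty : ∀ A B → eo A → c ₍₋ A ₎−δ B ≢ []
    nonEmpty (inside  ∷ A) B             eoA = 1∉eo A eoA
    nonEmpty (outside ∷ A) (inside  ∷ B) _   = λ ()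
    nonEmpty (outside ∷ A) (outside ∷ B) _   = λ ()

    part₁ : ∀ A B s → (A , B) ∈ˡ pairs 1 (𝒫 eo? (ones c)) (𝒫 ¬eo? (larges c)) →
            Words NonEmptyZWord (s · (𝔇-upTo n (c ₍₋ A ₎−δ B) * ⟦ replicate (∣ A ∣ ℕ.+ ∣ B ∣) x ⟧))
    part₁ A B s AB∈ with (_ , eoA) , _ ← ∈-pairs⁻ 1 eo? ¬eo? AB∈ =
      Words-· s (Words-* {Q = _≡ replicate m x} (λ { u _ Zu refl → ++-x m u Zu })
                  (proj₂ (𝔇-words n (c ₍₋ A ₎−δ B)) (nonEmpty A B eoA)) (Words-⟦⟧ {Q = _≡ replicate m x} refl))
      where m = ∣ A ∣ ℕ.+ ∣ B ∣

    part₂ : ∀ {P Q : Subset (length c) → Set} (P? : ∀ A → Dec (P A)) (Q? : ∀ A → Dec (Q A)) →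
            ∀ A B s → (A , B) ∈ˡ pairs 2 (𝒫 P? (ones c)) (𝒫 Q? (larges c)) →
            Words NonEmptyZWord (s · (𝔇-upTo n (c ₍₋ A ₎−δ B) * ⟦ z (∣ A ∣ ℕ.+ ∣ B ∣) ⟧))
    part₂ P? Q? A B s AB∈ with _ , _ , 2≤ ← ∈-pairs⁻ 2 P? Q? AB∈ =
      Words-· s (Words-* {Q = _≡ z m} (λ { u _ Zu refl → ++-z m u 2≤ Zu })
                  (proj₁ (𝔇-words n (c ₍₋ A ₎−δ B))) (Words-⟦⟧ {Q = _≡ z m} refl))
      where m = ∣ A ∣ ℕ.+ ∣ B ∣

    all : Words NonEmptyZWord (step (𝔇-upTo n) c)
    all = All.++⁺ (All.++⁺
      (Words-∑ (pairs 1 (𝒫 eo? _) (𝒫 ¬eo? _)) _ (λ (A , B) → part₁ A B (-1ℤ ℤ.^ suc ∣ B ∣)))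
      (Words-∑ (pairs 2 (𝒫 eo? _) (𝒫 ¬eo? _)) _ (λ (A , B) → part₂ eo? ¬eo? A B (-1ℤ ℤ.^ suc ∣ B ∣))))
      (Words-∑ (pairs 2 (𝒫 oe? _) (𝒫 ¬oe? _)) _ (λ (A , B) → part₂ oe? ¬oe? A B (-1ℤ ℤ.^ ∣ B ∣)))

  Words⇒∈ℋ≥² : ∀ {p} → Words IsZWord p → p ∈ℋ≥²
  Words⇒∈ℋ≥² [] = [] , λ w → refl
  Words⇒∈ℋ≥² {(a , _) ∷ p} ((ks , refl) ∷ Zp) with q , p≈ ← Words⇒∈ℋ≥² Zp =
    (a , ks) ∷ q , λ w → cong₂ (λ b c → (if does (List.≡-dec _≟ᴸ_ (zWord ks) w) then b else 0ℤ) ℤ.+ c)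
                               (sym (ℤ.*-identityʳ a)) (p≈ w)

𝒟-∈ℋ≥² : ∀ p → linear (𝔇 ∘ exponents) p ∈ℋ≥²
𝒟-∈ℋ≥² p = Words⇒∈ℋ≥² (Words-linear {P = λ _ → Word} (λ w _ → proj₁ (𝔇-words _ (exponents w)))
                                    (All.tabulate {xs = p} λ {t} _ → proj₂ t))

-- Since p ∈ ℋ⁰, any terms of p whose word is neither empty nor of the form
-- y ⋯ x cancel, so the value does not depend on what 𝔇 ∘ exponents gives there.
𝒟 : ℋ⁰ → ℋ≥²
𝒟 (p , _) = linear (𝔇 ∘ exponents) p , 𝒟-∈ℋ≥² p

private
  IsWord⁰ : Word → Set
  IsWord⁰ w = w ≡ [] ⊎ ∃ λ u → w ≡ y ∷ u ++ [ x ]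

  ++-⁰ : ∀ u v → IsWord⁰ u → IsWord⁰ v → IsWord⁰ (u ++ v)
  ++-⁰ _ _ (inj₁ refl)        v⁰                 = v⁰
  ++-⁰ _ _ (inj₂ (u , refl)) (inj₁ refl)        = inj₂ (u , List.++-identityʳ _)
  ++-⁰ _ _ (inj₂ (u , refl)) (inj₂ (v , refl)) =
    inj₂ (u ++ x ∷ y ∷ v , cong (y ∷_) (trans (List.++-assoc u [ x ] _) (sym (List.++-assoc u (x ∷ y ∷ v) [ x ]))))

  gen-⁰ : ∀ g → IsWord⁰ (genWord g)
  gen-⁰ z₂ = inj₂ ([] , refl)
  gen-⁰ z₃ = inj₂ ([ x ] , refl)

  gens-⁰ : ∀ w → IsWord⁰ (concatMap genWord w)
  gens-⁰ []      = inj₁ refl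
  gens-⁰ (g ∷ w) = ++-⁰ (genWord g) _ (gen-⁰ g) (gens-⁰ w)

  τ-⁰ : ∀ w → IsWord⁰ w → IsWord⁰ (reverse (map swap w))
  τ-⁰ _ (inj₁ refl)       = inj₁ refl
  τ-⁰ _ (inj₂ (u , refl)) = inj₂ (reverse (map swap u) , (begin
    reverse (x ∷ map swap (u ++ [ x ]))   ≡⟨ List.unfold-reverse x (map swap (u ++ [ x ])) ⟩
    reverse (map swap (u ++ [ x ])) ∷ʳ x  ≡⟨ cong (λ w → reverse w ∷ʳ x) (List.map-++ swap u [ x ]) ⟩
    reverse (map swap u ∷ʳ y) ∷ʳ x        ≡⟨ cong (_∷ʳ x) (List.reverse-++ (map swap u) [ y ]) ⟩
    y ∷ reverse (map swap u) ++ [ x ]     ∎))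
    where open ≡-Reasoning

  ι-⁰ : ∀ w → Words IsWord⁰ (ι w)
  ι-⁰ w = Words-linear {P = λ _ → List Gen} {f = λ u → ⟦ concatMap genWord u ⟧} (λ u _ → Words-⟦⟧ (gens-⁰ u)) (All.tabulate {xs = w} λ {t} _ → proj₂ t)

  δ : Word → Word → ℤ → ℤ
  δ u w a = if does (List.≡-dec _≟ᴸ_ u w) then a else 0ℤ

  δ-+ : ∀ u w a b → δ u w (a ℤ.+ b) ≡ δ u w a ℤ.+ δ u w b
  δ-+ u w a b with does (List.≡-dec _≟ᴸ_ u w)
  ... | Bool.true  = refl
  ... | Bool.false = refl

  Words⇒∈ℋ⁰ : ∀ {p} → Words IsWord⁰ p → p ∈ℋ⁰
  Words⇒∈ℋ⁰ [] = 0ℤ , [] , λ w → sym (trans (ℤ.+-identityʳ _) (δ-0 w))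
    where δ-0 : ∀ w → δ [] w 0ℤ ≡ 0ℤ
          δ-0 []      = refl
          δ-0 (_ ∷ _) = refl
  Words⇒∈ℋ⁰ {(a , _) ∷ p} (inj₁ refl ∷ p⁰) with n , q , p≈ ← Words⇒∈ℋ⁰ p⁰ =
    a ℤ.+ n , q , λ w → begin
      δ [] w a ℤ.+ coeff p w                       ≡⟨ cong (λ c → δ [] w a ℤ.+ c) (p≈ w) ⟩
      δ [] w a ℤ.+ (δ [] w n ℤ.+ rest q w)         ≡⟨ ℤ.+-assoc (δ [] w a) _ _ ⟨
      δ [] w a ℤ.+ δ [] w n ℤ.+ rest q w           ≡⟨ cong (ℤ._+ rest q w) (δ-+ [] w a n) ⟨
      δ [] w (a ℤ.+ n) ℤ.+ rest q w                ∎
    where open ≡-Reasoning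
          rest : ℋ → Word → ℤ
          rest q = coeff (⟦ [ y ] ⟧ * q * ⟦ [ x ] ⟧)
  Words⇒∈ℋ⁰ {(a , _) ∷ p} (inj₂ (u , refl) ∷ p⁰) with n , q , p≈ ← Words⇒∈ℋ⁰ p⁰ =
    n , (a , u) ∷ q , λ w → begin
      δ yux w a ℤ.+ coeff p w                      ≡⟨ cong (λ c → δ yux w a ℤ.+ c) (p≈ w) ⟩
      δ yux w a ℤ.+ (δ [] w n ℤ.+ rest q w)        ≡⟨ ℤ.+-assoc (δ yux w a) _ _ ⟨
      δ yux w a ℤ.+ δ [] w n ℤ.+ rest q w          ≡⟨ cong (ℤ._+ rest q w) (ℤ.+-comm (δ yux w a) _) ⟩
      δ [] w n ℤ.+ δ yux w a ℤ.+ rest q w          ≡⟨ ℤ.+-assoc (δ [] w n) _ _ ⟩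
      δ [] w n ℤ.+ (δ yux w a ℤ.+ rest q w)        ≡⟨ cong (λ b → δ [] w n ℤ.+ (δ yux w b ℤ.+ rest q w)) a′≡a ⟨
      δ [] w n ℤ.+ (δ yux w (1ℤ ℤ.* (a ℤ.* 1ℤ) ℤ.* (1ℤ ℤ.* 1ℤ)) ℤ.+ rest q w) ∎
    where open ≡-Reasoning
          yux = y ∷ u ++ [ x ]
          rest : ℋ → Word → ℤ
          rest q = coeff (⟦ [ y ] ⟧ * q * ⟦ [ x ] ⟧)
          a′≡a : 1ℤ ℤ.* (a ℤ.* 1ℤ) ℤ.* (1ℤ ℤ.* 1ℤ) ≡ a
          a′≡a = trans (ℤ.*-identityʳ _) (trans (ℤ.*-identityˡ _) (ℤ.*-identityʳ a))

w₁τw₂∈ℋ⁰ : ∀ w₁ w₂ → ι w₁ * τ (ι w₂) ∈ℋ⁰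
w₁τw₂∈ℋ⁰ w₁ w₂ = Words⇒∈ℋ⁰ (Words-* ++-⁰ (ι-⁰ w₁) 
  (Words-linear {f = λ w → ⟦ reverse (map swap w) ⟧} (λ w w⁰ → Words-⟦⟧ (τ-⁰ w w⁰)) (ι-⁰ w₂)))

{-# OPTIONS --safe #-}

-- Every word w₁ τ(w₂) has exponents 1 , a₁ - 1 , 1 , a₂ - 1 , … , b₂ - 1 , 1 , b₁ - 1 , 1, and
-- the recursion for 𝔇 stays within such tuples: deleting two adjacent ones deletes a
-- letter z₂, and lowering a 2 to 1 turns a letter z₃ into z₂.  Record the number of
-- units removed by a power of a central variable t.  The oe-sum is then the image
-- of the pair (w₁ , w₂) under z₂ ↦ z₂ + t², z₃ ↦ z₃ - t z₂; in the eo-sum this holds for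
-- all letters except the last letters of w₁ and w₂, which meet in one block.
-- Assume 𝔇 = ⋆ on shorter words.  By the rules for ⋆ the two sums differ by t² F,
-- where F z₂ and the eo-sum become equal once t^k is replaced by x^k on the right.
-- As z_{k+2} = z₂ x^k, everything in the recursion cancels except the term k = 0
-- absent from its first sum, and that term is w₁ ⋆ w₂.
-- Equality in ℋ is tested by applying all linear functionals to ℤ.

module Submission where

open import Defs
open import Data.Bool.Base using (Bool; true; false; T; if_then_else_; _∧_; _∨_; not)
open import Data.Empty using (⊥-elim)
open import Data.Fin.Base as Fin using (toℕ)
open import Data.Fin.Subset using (Subset; _∈_; _⊆_; ∣_∣)
open import Data.Fin.Subset.Properties using (_⊆?_; drop-∷-⊆; out⊆; s⊆s)
open import Data.Integer.Base as ℤ using (ℤ; +_; -[1+_]; 0ℤ; 1ℤ; -1ℤ)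
import Data.Integer.Properties as ℤ
open import Data.Integer.Divisibility using (_∣_)
open import Data.Integer.Tactic.RingSolver using (solve-∀)
open import Data.List.Base as List
  using (List; []; _∷_; _++_; _∷ʳ_; _∷ʳ′_; [_]; length; map; concatMap; replicate; reverse; filter; cartesianProduct)
import Data.List.Properties as List
open import Data.List.Relation.Unary.All using ([]; _∷_)
open import Data.Nat.Base as ℕ using (ℕ; zero; suc; _≤_; z≤n; s≤s)
import Data.Nat.Divisibility as ℕ
import Data.Nat.Properties as ℕ
open import Data.Nat.ListAction using (sum)
open import Data.Nat.Tactic.RingSolver using () renaming (solve-∀ to ℕ-solve)
open import Data.Product.Base using (∃; _×_; _,_; proj₁; proj₂)
open import Data.Sum.Base as Sum using (_⊎_; inj₁; inj₂)
open import Data.Unit.Base using (tt)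
open import Data.Vec.Base using ([]; _∷_; here; there)
open import Function.Base using (_∘_)
open import Function.Bundles using (mk⇔; Equivalence)
open import Relation.Binary.PropositionalEquality
  using (_≡_; _≢_; refl; sym; trans; cong; cong₂; subst; module ≡-Reasoning)
open import Relation.Nullary using (¬_; Dec; does)
open import Relation.Nullary.Decidable using (_×-dec_; T?)

open ≡-Reasoning

-- The word `w₁ τ(w₂)` does not determine the pair `(w₁ , w₂)`: as `τ(z₂) = z₂`, a `z₂` at the
-- junction can be given to either word. The product `⋆` has the same ambiguity, since a final `z₂`
-- may be taken off either factor, so an induction over pairs of words is consistent. The eo-blocks
-- of positions straddle the oe-blocks, yet away from the junction they contain the same entries in
-- the other order, which yields the same substitution. Only at the junction do the two readings
-- differ: there an eo-block holds the entries of both last letters, where an oe-block holds one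
-- such entry and a 1. If one word is empty, the entry stands alone at an end of the tuple; hence
-- three cases, whose common properties are collected in one record. With t of degree 1 the
-- substitution is homogeneous for the degree in x and y. A term with t^k therefore concerns words
-- of total degree smaller by k, and every term with k ≥ 1 is covered by induction on the degree.
-- The term k = 0 is the pair itself, which the induction hypothesis does not reach; every sum of
-- the recursion excludes it.

private variable
  X Y I J : Set
  n : ℕ

-- Finite sums of integers

interchange : ∀ a b c d → a ℤ.+ b ℤ.+ (c ℤ.+ d) ≡ a ℤ.+ c ℤ.+ (b ℤ.+ d)
interchange = solve-∀

interchange-- : ∀ a b c d → a ℤ.+ b ℤ.- (c ℤ.+ d) ≡ a ℤ.- c ℤ.+ (b ℤ.- d)
interchange-- = solve-∀

sumOver : List I → (I → ℤ) → ℤ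
sumOver []       f = 0ℤ
sumOver (i ∷ is) f = f i ℤ.+ sumOver is f

sumOver-cong : (is : List I) {f g : I → ℤ} → (∀ i → f i ≡ g i) → sumOver is f ≡ sumOver is g
sumOver-cong []       h = refl
sumOver-cong (i ∷ is) h = cong₂ ℤ._+_ (h i) (sumOver-cong is h)

sumOver-++ : (is js : List I) (f : I → ℤ) → sumOver (is ++ js) f ≡ sumOver is f ℤ.+ sumOver js f
sumOver-++ []       js f = sym (ℤ.+-identityˡ _)
sumOver-++ (i ∷ is) js f = trans (cong (λ t → f i ℤ.+ t) (sumOver-++ is js f)) (sym (ℤ.+-assoc (f i) _ _))

sumOver-map : (g : J → I) (js : List J) (f : I → ℤ) → sumOver (map g js) f ≡ sumOver js (f ∘ g)
sumOver-map g []       f = refl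
sumOver-map g (j ∷ js) f = cong (λ t → f (g j) ℤ.+ t) (sumOver-map g js f)

sumOver-+ : (is : List I) (f g : I → ℤ) →
            sumOver is (λ i → f i ℤ.+ g i) ≡ sumOver is f ℤ.+ sumOver is g
sumOver-+ []       f g = refl
sumOver-+ (i ∷ is) f g = trans (cong (λ t → f i ℤ.+ g i ℤ.+ t) (sumOver-+ is f g))
                               (interchange (f i) (g i) (sumOver is f) (sumOver is g))

sumOver-neg : (is : List I) (f : I → ℤ) → sumOver is (λ i → ℤ.- f i) ≡ ℤ.- sumOver is f
sumOver-neg []       f = refl
sumOver-neg (i ∷ is) f = trans (cong (λ t → ℤ.- f i ℤ.+ t) (sumOver-neg is f))
                               (sym (ℤ.neg-distrib-+ (f i) (sumOver is f)))

sumOver-cartesianProduct : (is : List I) (js : List J) (f : I × J → ℤ) →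
  sumOver (cartesianProduct is js) f ≡ sumOver is λ i → sumOver js λ j → f (i , j)
sumOver-cartesianProduct []       js f = refl
sumOver-cartesianProduct (i ∷ is) js f = trans (sumOver-++ (map (i ,_) js) _ f)
  (cong₂ ℤ._+_ (sumOver-map (i ,_) js f) (sumOver-cartesianProduct is js f))

sumOver-filter : {P : I → Set} (P? : ∀ i → Dec (P i)) (is : List I) (f : I → ℤ) →
  sumOver (filter P? is) f ≡ sumOver is λ i → if does (P? i) then f i else 0ℤ
sumOver-filter P? []       f = refl
sumOver-filter P? (i ∷ is) f with does (P? i)
... | true  = cong (λ t → f i ℤ.+ t) (sumOver-filter P? is f)
... | false = trans (sumOver-filter P? is f) (sym (ℤ.+-identityˡ _))

-- Linear functionals on free rings

eval : (List X → ℤ) → ℤ⟨ X ⟩ → ℤ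
eval φ p = sumOver p λ (a , w) → a ℤ.* φ w

eval-cong : {φ ψ : List X → ℤ} (p : ℤ⟨ X ⟩) → (∀ w → φ w ≡ ψ w) → eval φ p ≡ eval ψ p
eval-cong p h = sumOver-cong p λ (a , w) → cong (a ℤ.*_) (h w)

eval-+ : (φ : List X → ℤ) (p q : ℤ⟨ X ⟩) → eval φ (p + q) ≡ eval φ p ℤ.+ eval φ q
eval-+ φ p q = sumOver-++ p q _

eval-· : (φ : List X → ℤ) (a : ℤ) (p : ℤ⟨ X ⟩) → eval φ (a · p) ≡ a ℤ.* eval φ p
eval-· φ a []            = sym (ℤ.*-zeroʳ a)
eval-· φ a ((b , w) ∷ p) = trans (cong₂ ℤ._+_ (ℤ.*-assoc a b (φ w)) (eval-· φ a p))
                                 (sym (ℤ.*-distribˡ-+ a _ _))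

eval-∑ : (φ : List X → ℤ) (is : List I) (f : I → ℤ⟨ X ⟩) → eval φ (∑ is f) ≡ sumOver is (eval φ ∘ f)
eval-∑ φ []       f = refl
eval-∑ φ (i ∷ is) f = trans (eval-+ φ (f i) (∑ is f)) (cong (λ t → eval φ (f i) ℤ.+ t) (eval-∑ φ is f))

eval-⟦⟧ : (φ : List X → ℤ) (w : List X) → eval φ ⟦ w ⟧ ≡ φ w
eval-⟦⟧ φ w = trans (ℤ.+-identityʳ _) (ℤ.*-identityˡ (φ w))

eval-linear : (φ : List Y → ℤ) (f : List X → ℤ⟨ Y ⟩) (p : ℤ⟨ X ⟩) →
              eval φ (linear f p) ≡ eval (eval φ ∘ f) p
eval-linear φ f p = trans (eval-∑ φ p _) (sumOver-cong p λ (a , w) → eval-· φ a (f w))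

eval-* : (φ : List X → ℤ) (p q : ℤ⟨ X ⟩) → eval φ (p * q) ≡ eval (λ u → eval (λ v → φ (u ++ v)) q) p
eval-* φ p q = trans (eval-linear φ (λ u → linear (λ v → ⟦ u ++ v ⟧) q) p) (eval-cong p λ u →
  trans (eval-linear φ (λ v → ⟦ u ++ v ⟧) q) (eval-cong q λ v → eval-⟦⟧ φ (u ++ v)))

infixl 7 _▹_
-- Right multiplication by `v`, transposed to functionals. Since the recursion multiplies by varying
-- words on the right, the induction hypothesis has to hold for all functionals at once.
_▹_ : (List X → ℤ) → List X → List X → ℤ
(φ ▹ v) w = φ (w ++ v)

eval-*⟦⟧ : (φ : List X → ℤ) (p : ℤ⟨ X ⟩) (v : List X) → eval φ (p * ⟦ v ⟧) ≡ eval (φ ▹ v) p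
eval-*⟦⟧ φ p v = trans (eval-* φ p ⟦ v ⟧) (eval-cong p λ u → eval-⟦⟧ (λ v → φ (u ++ v)) v)

indicator : Word → Word → ℤ
indicator w u = if does (List.≡-dec _≟ᴸ_ u w) then 1ℤ else 0ℤ

coeff≡eval : ∀ p w → coeff p w ≡ eval (indicator w) p
coeff≡eval []            w = refl
coeff≡eval ((a , u) ∷ p) w = cong₂ ℤ._+_ scaled (coeff≡eval p w)
  where
  scaled : (if does (List.≡-dec _≟ᴸ_ u w) then a else 0ℤ) ≡ a ℤ.* indicator w u
  scaled with does (List.≡-dec _≟ᴸ_ u w)
  ... | true  = sym (ℤ.*-identityʳ a)
  ... | false = sym (ℤ.*-zeroʳ a)

-- Each coefficient is itself a functional of this kind, namely `eval (indicator w)`.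
≈-by-eval : ∀ {p q} → (∀ φ → eval φ p ≡ eval φ q) → p ≈ q
≈-by-eval {p} {q} h w = trans (coeff≡eval p w) (trans (h (indicator w)) (sym (coeff≡eval q w)))

-- Even-odd and odd-even pairs in a subset

-- mem A k says whether the integer 1 + k lies in A.
mem : Subset n → ℕ → Bool
mem []      _       = false
mem (a ∷ A) zero    = a
mem (a ∷ A) (suc k) = mem A k

∋⇒mem : ∀ {A : Subset n} {k} → A ∋ + suc k → mem A k ≡ true
∋⇒mem (j , j∈A , refl) = go j∈A
  where
  go : ∀ {n} {A : Subset n} {j} → j ∈ A → mem A (toℕ j) ≡ true
  go here        = refl
  go (there j∈A) = go j∈A

mem⇒∋ : ∀ {A : Subset n} k → mem A k ≡ true → A ∋ + suc k
mem⇒∋ {A = true ∷ A} zero    refl = Fin.zero , here , refl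
mem⇒∋ {A = a ∷ A}    (suc k) e with mem⇒∋ {A = A} k e
... | j , j∈A , refl = Fin.suc j , there j∈A , refl

∌0 : {A : Subset n} → ¬ (A ∋ 0ℤ)
∌0 (_ , _ , ())

double : ℕ → ℕ
double zero    = zero
double (suc k) = suc (suc (double k))

2∣double : ∀ k → + 2 ∣ + double k
2∣double k = subst (2 ℕ.∣_) (sym (double≡2* k)) (ℕ.m∣m*n k)
  where
  double≡2* : ∀ k → double k ≡ 2 ℕ.* k
  double≡2* zero    = refl
  double≡2* (suc k) = cong suc (trans (cong suc (double≡2* k)) (sym (ℕ.+-suc k _)))

2∤1+double : ∀ k → ¬ (+ 2 ∣ + suc (double k))
2∤1+double k h with ℕ.∣⇒≤ (ℕ.∣m+n∣m⇒∣n (subst (2 ℕ.∣_) (ℕ.+-comm 1 (double k)) h) (2∣double k))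
... | s≤s ()

even⊎odd : ∀ n → (∃ λ k → n ≡ double k) ⊎ (∃ λ k → n ≡ suc (double k))
even⊎odd zero = inj₁ (zero , refl)
even⊎odd (suc n) with even⊎odd n
... | inj₁ (k , refl) = inj₂ (k , refl)
... | inj₂ (k , refl) = inj₁ (suc k , refl)

∋+1⇒ : ∀ {A : Subset n} {i} → A ∋ i ℤ.+ 1ℤ → ∃ λ k → i ≡ + k × mem A k ≡ true
∋+1⇒ {A = A} {+ k}         A∋ = k , refl , ∋⇒mem {A = A} (subst (A ∋_) (cong +_ (ℕ.+-comm k 1)) A∋)
∋+1⇒ {i = -[1+ zero ]}  (_ , _ , ())
∋+1⇒ {i = -[1+ suc k ]} (_ , _ , ())

∋⇒ : ∀ {A : Subset n} {i} → A ∋ i → ∃ λ k → i ≡ + suc k × mem A k ≡ true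
∋⇒ {A = A} A∋@(j , _ , refl) = toℕ j , refl , ∋⇒mem {A = A} A∋

mem⇒∋+1 : ∀ {A : Subset n} k → mem A k ≡ true → A ∋ + k ℤ.+ 1ℤ
mem⇒∋+1 {A = A} k e = subst (A ∋_) (cong +_ (ℕ.+-comm 1 k)) (mem⇒∋ {A = A} k e)

2∤double+1 : ∀ k → ¬ (+ 2 ∣ + double k ℤ.+ 1ℤ)
2∤double+1 k = subst (λ n → ¬ (2 ℕ.∣ n)) (ℕ.+-comm 1 (double k)) (2∤1+double k)

2∣1+double+1 : ∀ k → + 2 ∣ + suc (double k) ℤ.+ 1ℤ
2∣1+double+1 k = subst (2 ℕ.∣_) (ℕ.+-comm 1 (suc (double k))) (2∣double (suc k))

-- Offset `double k` is the odd integer 1 + 2k, so on a whole subset these are the oe-conditions.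
-- Stated on offsets, they also apply to a tail, where they become the eo-conditions of the subset
-- with one more position in front.
Paired Unpaired : Subset n → Set
Paired   A = ∀ k → mem A (double k) ≡ mem A (suc (double k))
Unpaired A = ∀ k → mem A (double k) ≡ true → ¬ (mem A (suc (double k)) ≡ true)

≡-by-⇔ : ∀ {a b} → (a ≡ true → b ≡ true) → (b ≡ true → a ≡ true) → a ≡ b
≡-by-⇔ {false} {false} f g = refl
≡-by-⇔ {false} {true}  f g = g refl
≡-by-⇔ {true}          f g = sym (f refl)

oe⇒Paired : (A : Subset n) → oe A → Paired A
oe⇒Paired A oeA k = ≡-by-⇔
  (λ e → let A∋ , _ = Equivalence.to (oeA (+ suc (double k))) (mem⇒∋ {A = A} (double k) e , 2∤1+double k)
             m , eq , e′ = ∋+1⇒ {A = A} {+ suc (double k)} A∋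
         in subst (λ m → mem A m ≡ true) (ℤ.+-injective (sym eq)) e′)
  (λ e → let A∋ , _ = Equivalence.from (oeA (+ suc (double k))) (mem⇒∋+1 {A = A} (suc (double k)) e , 2∣1+double+1 k)
         in ∋⇒mem {A = A} A∋)

Paired⇒oe : (A : Subset n) → Paired A → oe A
Paired⇒oe A pA i = mk⇔ to from
  where
  to : i ∈ A ∖2ℤ → i ℤ.+ 1ℤ ∈ A ∩2ℤ
  to (A∋ , odd) with ∋⇒ {A = A} A∋
  ... | m , refl , e with even⊎odd m
  ... | inj₁ (k , refl) = mem⇒∋+1 {A = A} (suc (double k)) (trans (sym (pA k)) e) , 2∣1+double+1 k
  ... | inj₂ (k , refl) = ⊥-elim (odd (2∣double (suc k)))
  from : i ℤ.+ 1ℤ ∈ A ∩2ℤ → i ∈ A ∖2ℤ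
  from (A∋ , even) with ∋+1⇒ {A = A} {i} A∋
  ... | m , refl , e with even⊎odd m
  ... | inj₁ (k , refl) = ⊥-elim (2∤double+1 k even)
  ... | inj₂ (k , refl) = mem⇒∋ {A = A} (double k) (trans (pA k) e) , 2∤1+double k

-- The partner of 1 would be 0, which lies in no subset, so 1 is excluded. The other pairs (2,3),
-- (4,5), ... are the pairs (1,2), (3,4), ... of the tail.
eo⇒Paired : ∀ a (A : Subset n) → eo (a ∷ A) → a ≡ false × Paired A
eo⇒Paired a A eoA = 1∉ a eoA , λ k → ≡-by-⇔
  (λ e → let A∋ , _ = Equivalence.to (eoA (+ double (suc k))) (mem⇒∋ {A = a ∷ A} (suc (double k)) e , 2∣double (suc k))
             m , eq , e′ = ∋+1⇒ {A = a ∷ A} {+ double (suc k)} A∋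
         in subst (λ m → mem (a ∷ A) m ≡ true) (ℤ.+-injective (sym eq)) e′)
  (λ e → let A∋ , _ = Equivalence.from (eoA (+ double (suc k))) (mem⇒∋+1 {A = a ∷ A} (double (suc k)) e , 2∤double+1 (suc k))
         in ∋⇒mem {A = a ∷ A} A∋)
  where
  1∉ : ∀ a → eo (a ∷ A) → a ≡ false
  1∉ false _   = refl
  1∉ true  eoA = ⊥-elim (∌0 {A = true ∷ A} (proj₁
    (Equivalence.from (eoA 0ℤ) (mem⇒∋+1 {A = true ∷ A} 0 refl , 2∤double+1 0))))

Paired⇒eo : (A : Subset n) → Paired A → eo (false ∷ A)
Paired⇒eo A pA i = mk⇔ to from
  where
  to : i ∈ false ∷ A ∩2ℤ → i ℤ.+ 1ℤ ∈ false ∷ A ∖2ℤ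
  to (A∋ , even) with ∋⇒ {A = false ∷ A} A∋
  ... | suc m , refl , e with even⊎odd m
  ... | inj₁ (k , refl) = mem⇒∋+1 {A = false ∷ A} (double (suc k)) (trans (sym (pA k)) e) , 2∤double+1 (suc k)
  ... | inj₂ (k , refl) = ⊥-elim (2∤1+double (suc k) even)
  from : i ℤ.+ 1ℤ ∈ false ∷ A ∖2ℤ → i ∈ false ∷ A ∩2ℤ
  from (A∋ , odd) with ∋+1⇒ {A = false ∷ A} {i} A∋
  ... | suc m , refl , e with even⊎odd m
  ... | inj₁ (k , refl) = ⊥-elim (odd (2∣1+double+1 k))
  ... | inj₂ (k , refl) = mem⇒∋ {A = false ∷ A} (suc (double k)) (trans (pA k) e) , 2∣double (suc k)

¬oe⇒Unpaired : (A : Subset n) → ¬oe A → Unpaired A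
¬oe⇒Unpaired A h k e e′ = h (+ suc (double k))
  (mem⇒∋ {A = A} (double k) e , 2∤1+double k) (mem⇒∋+1 {A = A} (suc (double k)) e′ , 2∣1+double+1 k)

Unpaired⇒¬oe : (A : Subset n) → Unpaired A → ¬oe A
Unpaired⇒¬oe A uA i (A∋ , odd) (A∋+1 , _) with ∋⇒ {A = A} A∋ | ∋+1⇒ {A = A} {i} A∋+1
... | m , refl , e | _ , refl , e′ with even⊎odd m
... | inj₁ (k , refl) = uA k e e′
... | inj₂ (k , refl) = odd (2∣double (suc k))

-- In contrast to `eo`, the first position is unconstrained here: 1 could only be forbidden by the
-- presence of 0. Hence `a` is arbitrary.
¬eo⇒Unpaired : ∀ a (A : Subset n) → ¬eo (a ∷ A) → Unpaired A
¬eo⇒Unpaired a A h k e e′ = h (+ double (suc k))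
  (mem⇒∋ {A = a ∷ A} (suc (double k)) e , 2∣double (suc k)) (mem⇒∋+1 {A = a ∷ A} (double (suc k)) e′ , 2∤double+1 (suc k))

Unpaired⇒¬eo : ∀ a (A : Subset n) → Unpaired A → ¬eo (a ∷ A)
Unpaired⇒¬eo a A uA i (A∋ , even) (A∋+1 , _) with ∋⇒ {A = a ∷ A} A∋ | ∋+1⇒ {A = a ∷ A} {i} A∋+1
... | zero  , refl , e | _ , refl , e′ = 2∤1+double 0 even
... | suc m , refl , e | _ , refl , e′ with even⊎odd m
... | inj₁ (k , refl) = uA k e e′
... | inj₂ (k , refl) = 2∤1+double (suc k) even

⊆-∷⁻ : ∀ {a s} {A S : Subset n} → (a ∷ A) ⊆ (s ∷ S) → a ≡ true → s ≡ true
⊆-∷⁻ {a = true} {true}  A⊆S refl = refl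
⊆-∷⁻ {a = true} {false} A⊆S refl with () ← A⊆S here

-- Inclusion and pairing are tested together, two positions at a time, so that filtering
-- `allSubsets` can be computed block by block. A lone last position has no partner: a paired set
-- must avoid it, an unpaired set may contain it.
pairedIn unpairedIn : Subset n → Subset n → Bool
pairedIn []          []                  = true
pairedIn (s ∷ [])    (a ∷ [])            = not a
pairedIn (s ∷ t ∷ S) (false ∷ false ∷ A) = pairedIn S A
pairedIn (s ∷ t ∷ S) (false ∷ true  ∷ A) = false
pairedIn (s ∷ t ∷ S) (true  ∷ false ∷ A) = false
pairedIn (s ∷ t ∷ S) (true  ∷ true  ∷ A) = s ∧ t ∧ pairedIn S A

unpairedIn []          []                  = true
unpairedIn (s ∷ [])    (a ∷ [])            = not a ∨ s
unpairedIn (s ∷ t ∷ S) (false ∷ false ∷ B) = unpairedIn S B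
unpairedIn (s ∷ t ∷ S) (false ∷ true  ∷ B) = t ∧ unpairedIn S B
unpairedIn (s ∷ t ∷ S) (true  ∷ false ∷ B) = s ∧ unpairedIn S B
unpairedIn (s ∷ t ∷ S) (true  ∷ true  ∷ B) = false

pairedIn⇒ : (S A : Subset n) → T (pairedIn S A) → A ⊆ S × Paired A
pairedIn⇒ []          []                  _ = (λ ()) , λ _ → refl
pairedIn⇒ (s ∷ [])    (false ∷ [])        _ = out⊆ (λ ()) , λ { zero → refl ; (suc _) → refl }
pairedIn⇒ (s ∷ t ∷ S) (false ∷ false ∷ A) h with A⊆S , pA ← pairedIn⇒ S A h =
  out⊆ (out⊆ A⊆S) , λ { zero → refl ; (suc k) → pA k }
pairedIn⇒ (true ∷ true ∷ S) (true ∷ true ∷ A) h with A⊆S , pA ← pairedIn⇒ S A h =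
  s⊆s (s⊆s A⊆S) , λ { zero → refl ; (suc k) → pA k }

⇒pairedIn : (S A : Subset n) → A ⊆ S → Paired A → T (pairedIn S A)
⇒pairedIn []          []                  _ _  = tt
⇒pairedIn (s ∷ [])    (false ∷ [])        _ _  = tt
⇒pairedIn (s ∷ [])    (true ∷ [])         _ pA with () ← pA 0
⇒pairedIn (s ∷ t ∷ S) (false ∷ false ∷ A) h pA = ⇒pairedIn S A (drop-∷-⊆ (drop-∷-⊆ h)) (pA ∘ suc)
⇒pairedIn (s ∷ t ∷ S) (false ∷ true  ∷ A) h pA with () ← pA 0
⇒pairedIn (s ∷ t ∷ S) (true  ∷ false ∷ A) h pA with () ← pA 0
⇒pairedIn (s ∷ t ∷ S) (true  ∷ true  ∷ A) h pA
  with refl ← ⊆-∷⁻ h refl | refl ← ⊆-∷⁻ (drop-∷-⊆ h) refl = ⇒pairedIn S A (drop-∷-⊆ (drop-∷-⊆ h)) (pA ∘ suc)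

unpairedIn⇒ : (S B : Subset n) → T (unpairedIn S B) → B ⊆ S × Unpaired B
unpairedIn⇒ []          []                  _ = (λ ()) , λ _ ()
unpairedIn⇒ (s ∷ [])    (false ∷ [])        _ = out⊆ (λ ()) , λ { zero () ; (suc _) () }
unpairedIn⇒ (true ∷ []) (true ∷ [])         _ = s⊆s (λ ()) , λ { zero _ () ; (suc _) () }
unpairedIn⇒ (s ∷ t ∷ S) (false ∷ false ∷ B) h with B⊆S , uB ← unpairedIn⇒ S B h =
  out⊆ (out⊆ B⊆S) , λ { zero () ; (suc k) → uB k }
unpairedIn⇒ (s ∷ true ∷ S) (false ∷ true ∷ B) h with B⊆S , uB ← unpairedIn⇒ S B h =
  out⊆ (s⊆s B⊆S) , λ { zero () ; (suc k) → uB k }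
unpairedIn⇒ (true ∷ t ∷ S) (true ∷ false ∷ B) h with B⊆S , uB ← unpairedIn⇒ S B h =
  s⊆s (out⊆ B⊆S) , λ { zero _ () ; (suc k) → uB k }

⇒unpairedIn : (S B : Subset n) → B ⊆ S → Unpaired B → T (unpairedIn S B)
⇒unpairedIn []          []                  _ _  = tt
⇒unpairedIn (s ∷ [])    (false ∷ [])        _ _  = tt
⇒unpairedIn (s ∷ [])    (true ∷ [])         h _  with refl ← ⊆-∷⁻ h refl = tt
⇒unpairedIn (s ∷ t ∷ S) (false ∷ false ∷ B) h uB = ⇒unpairedIn S B (drop-∷-⊆ (drop-∷-⊆ h)) (uB ∘ suc)
⇒unpairedIn (s ∷ t ∷ S) (false ∷ true  ∷ B) h uB
  with refl ← ⊆-∷⁻ (drop-∷-⊆ h) refl = ⇒unpairedIn S B (drop-∷-⊆ (drop-∷-⊆ h)) (uB ∘ suc)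
⇒unpairedIn (s ∷ t ∷ S) (true  ∷ false ∷ B) h uB
  with refl ← ⊆-∷⁻ h refl = ⇒unpairedIn S B (drop-∷-⊆ (drop-∷-⊆ h)) (uB ∘ suc)
⇒unpairedIn (s ∷ t ∷ S) (true  ∷ true  ∷ B) h uB = ⊥-elim (uB 0 refl refl)

-- The conditions oe and ¬oe are independent on the blocks {1,2}, {3,4}, … of positions.
pairedSubsets unpairedSubsets : Subset n → List (Subset n)
pairedSubsets []                 = [ [] ]
pairedSubsets (s ∷ [])           = [ false ∷ [] ]
pairedSubsets (true  ∷ true ∷ S) = map (λ A → false ∷ false ∷ A) (pairedSubsets S)
                                ++ map (λ A → true ∷ true ∷ A) (pairedSubsets S)
pairedSubsets (true  ∷ false ∷ S) = map (λ A → false ∷ false ∷ A) (pairedSubsets S)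
pairedSubsets (false ∷ t ∷ S)     = map (λ A → false ∷ false ∷ A) (pairedSubsets S)

unpairedSubsets []                   = [ [] ]
unpairedSubsets (false ∷ [])         = [ false ∷ [] ]
unpairedSubsets (true  ∷ [])         = (false ∷ []) ∷ (true ∷ []) ∷ []
unpairedSubsets (false ∷ false ∷ S)  = map (λ B → false ∷ false ∷ B) (unpairedSubsets S)
unpairedSubsets (false ∷ true  ∷ S)  = map (λ B → false ∷ false ∷ B) (unpairedSubsets S)
                                    ++ map (λ B → false ∷ true ∷ B) (unpairedSubsets S)
unpairedSubsets (true  ∷ false ∷ S)  = map (λ B → false ∷ false ∷ B) (unpairedSubsets S)
                                    ++ map (λ B → true ∷ false ∷ B) (unpairedSubsets S)
unpairedSubsets (true  ∷ true  ∷ S)  = map (λ B → false ∷ false ∷ B) (unpairedSubsets S)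
                                    ++ map (λ B → false ∷ true ∷ B) (unpairedSubsets S)
                                    ++ map (λ B → true ∷ false ∷ B) (unpairedSubsets S)

-- Enumeration of the paired and unpaired subsets

enumerate : (Subset n → Bool) → List (Subset n)
enumerate p = filter (T? ∘ p) (allSubsets _)

filterᵇ-map : (p : J → Bool) (f : I → J) (is : List I) → filter (T? ∘ p) (map f is) ≡ map f (filter (T? ∘ p ∘ f) is)
filterᵇ-map p f []       = refl
filterᵇ-map p f (i ∷ is) with p (f i)
... | true  = cong (f i ∷_) (filterᵇ-map p f is)
... | false = filterᵇ-map p f is

filterᵇ-false : (is : List I) → filter (λ _ → T? false) is ≡ []
filterᵇ-false []       = refl
filterᵇ-false (i ∷ is) = filterᵇ-false is

none : enumerate {n} (λ _ → false) ≡ []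
none = filterᵇ-false (allSubsets _)

enumerate-∷ : (p : Subset (suc n) → Bool) {L₀ L₁ : List (Subset n)} →
  enumerate (p ∘ (false ∷_)) ≡ L₀ → enumerate (p ∘ (true ∷_)) ≡ L₁ →
  enumerate p ≡ map (false ∷_) L₀ ++ map (true ∷_) L₁
enumerate-∷ {n} p refl refl = trans (List.filter-++ (T? ∘ p) (map (false ∷_) (allSubsets n)) _)
  (cong₂ _++_ (filterᵇ-map p (false ∷_) (allSubsets n)) (filterᵇ-map p (true ∷_) (allSubsets n)))

enumerate-∷∷ : (p : Subset (suc (suc n)) → Bool) {L₀₀ L₀₁ L₁₀ L₁₁ : List (Subset n)} →
  enumerate (λ A → p (false ∷ false ∷ A)) ≡ L₀₀ → enumerate (λ A → p (false ∷ true ∷ A)) ≡ L₀₁ →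
  enumerate (λ A → p (true ∷ false ∷ A)) ≡ L₁₀ → enumerate (λ A → p (true ∷ true ∷ A)) ≡ L₁₁ →
  enumerate p ≡ map (λ A → false ∷ false ∷ A) L₀₀ ++ map (λ A → false ∷ true ∷ A) L₀₁
             ++ map (λ A → true ∷ false ∷ A) L₁₀ ++ map (λ A → true ∷ true ∷ A) L₁₁
enumerate-∷∷ {n} p {L₀₀} {L₀₁} {L₁₀} {L₁₁} e₀₀ e₀₁ e₁₀ e₁₁ = begin
  enumerate p
    ≡⟨ enumerate-∷ p (enumerate-∷ (p ∘ (false ∷_)) e₀₀ e₀₁) (enumerate-∷ (p ∘ (true ∷_)) e₁₀ e₁₁) ⟩
  map (false ∷_) (map (false ∷_) L₀₀ ++ map (true ∷_) L₀₁) ++ map (true ∷_) (map (false ∷_) L₁₀ ++ map (true ∷_) L₁₁)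
    ≡⟨ cong₂ _++_ (half false L₀₀ L₀₁) (half true L₁₀ L₁₁) ⟩
  (map (λ A → false ∷ false ∷ A) L₀₀ ++ map (λ A → false ∷ true ∷ A) L₀₁)
    ++ map (λ A → true ∷ false ∷ A) L₁₀ ++ map (λ A → true ∷ true ∷ A) L₁₁
    ≡⟨ List.++-assoc (map (λ A → false ∷ false ∷ A) L₀₀) _ _ ⟩
  _ ∎
  where
  half : ∀ a (L L′ : List (Subset n)) → map (a ∷_) (map (false ∷_) L ++ map (true ∷_) L′) ≡
         map (λ A → a ∷ false ∷ A) L ++ map (λ A → a ∷ true ∷ A) L′
  half a L L′ = trans (List.map-++ (a ∷_) (map (false ∷_) L) _)
                      (cong₂ _++_ (sym (List.map-∘ L)) (sym (List.map-∘ L′)))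

enumerate-paired : (S : Subset n) → enumerate (pairedIn S) ≡ pairedSubsets S
enumerate-paired []       = refl
enumerate-paired (s ∷ []) = refl
enumerate-paired S₂@(true  ∷ true  ∷ S) =
  enumerate-∷∷ (pairedIn S₂) (enumerate-paired S) none none (enumerate-paired S)
enumerate-paired S₂@(true  ∷ false ∷ S) =
  trans (enumerate-∷∷ (pairedIn S₂) (enumerate-paired S) none none none) (List.++-identityʳ _)
enumerate-paired S₂@(false ∷ t     ∷ S) =
  trans (enumerate-∷∷ (pairedIn S₂) (enumerate-paired S) none none none) (List.++-identityʳ _)

enumerate-unpaired : (S : Subset n) → enumerate (unpairedIn S) ≡ unpairedSubsets S
enumerate-unpaired []           = refl
enumerate-unpaired (false ∷ []) = refl
enumerate-unpaired (true  ∷ []) = refl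
enumerate-unpaired S₂@(false ∷ false ∷ S) =
  trans (enumerate-∷∷ (unpairedIn S₂) (enumerate-unpaired S) none none none) (List.++-identityʳ _)
enumerate-unpaired S₂@(false ∷ true  ∷ S) =
  trans (enumerate-∷∷ (unpairedIn S₂) (enumerate-unpaired S) (enumerate-unpaired S) none none)
        (cong (map _ (unpairedSubsets S) ++_) (List.++-identityʳ _))
enumerate-unpaired S₂@(true  ∷ false ∷ S) =
  trans (enumerate-∷∷ (unpairedIn S₂) (enumerate-unpaired S) none (enumerate-unpaired S) none)
        (cong (map _ (unpairedSubsets S) ++_) (List.++-identityʳ _))
enumerate-unpaired S₂@(true  ∷ true  ∷ S) =
  trans (enumerate-∷∷ (unpairedIn S₂) (enumerate-unpaired S) (enumerate-unpaired S) (enumerate-unpaired S) none)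
        (cong (λ L → map _ (unpairedSubsets S) ++ map _ (unpairedSubsets S) ++ L) (List.++-identityʳ _))

𝒫≡enumerate : {Q : Subset n → Set} (Q? : ∀ A → Dec (Q A)) (S : Subset n) (p : Subset n → Bool) →
  (∀ A → A ⊆ S → Q A → T (p A)) → (∀ A → T (p A) → A ⊆ S × Q A) → 𝒫 Q? S ≡ enumerate p
𝒫≡enumerate Q? S p to from = List.filter-≐ (λ A → (A ⊆? S) ×-dec Q? A) (T? ∘ p)
  ((λ {A} (A⊆S , qA) → to A A⊆S qA) , λ {A} → from A) (allSubsets _)

𝒫-oe : (S : Subset n) → 𝒫 oe? S ≡ pairedSubsets S
𝒫-oe S = trans (𝒫≡enumerate oe? S (pairedIn S)
  (λ A A⊆S oeA → ⇒pairedIn S A A⊆S (oe⇒Paired A oeA))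
  (λ A h → let A⊆S , pA = pairedIn⇒ S A h in A⊆S , Paired⇒oe A pA))
  (enumerate-paired S)

𝒫-¬oe : (S : Subset n) → 𝒫 ¬oe? S ≡ unpairedSubsets S
𝒫-¬oe S = trans (𝒫≡enumerate ¬oe? S (unpairedIn S)
  (λ B B⊆S h → ⇒unpairedIn S B B⊆S (¬oe⇒Unpaired B h))
  (λ B h → let B⊆S , uB = unpairedIn⇒ S B h in B⊆S , Unpaired⇒¬oe B uB))
  (enumerate-unpaired S)

𝒫-eo : ∀ s (S : Subset n) → 𝒫 eo? (s ∷ S) ≡ map (false ∷_) (pairedSubsets S)
𝒫-eo {n} s S = begin
  𝒫 eo? (s ∷ S)  ≡⟨ 𝒫≡enumerate eo? (s ∷ S) p to from ⟩
  enumerate p     ≡⟨ enumerate-∷ p (enumerate-paired S) none ⟩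
  map (false ∷_) (pairedSubsets S) ++ []  ≡⟨ List.++-identityʳ _ ⟩
  map (false ∷_) (pairedSubsets S)        ∎
  where
  p : Subset (suc n) → Bool
  p (a ∷ A) = not a ∧ pairedIn S A
  to : ∀ A → A ⊆ s ∷ S → eo A → T (p A)
  to (a ∷ A) A⊆S eoA with refl , pA ← eo⇒Paired a A eoA = ⇒pairedIn S A (drop-∷-⊆ A⊆S) pA
  from : ∀ A → T (p A) → A ⊆ s ∷ S × eo A
  from (false ∷ A) h with A⊆S , pA ← pairedIn⇒ S A h = out⊆ A⊆S , Paired⇒eo A pA

𝒫-¬eo : ∀ s (S : Subset n) → 𝒫 ¬eo? (s ∷ S) ≡
        map (false ∷_) (unpairedSubsets S) ++ (if s then map (true ∷_) (unpairedSubsets S) else [])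
𝒫-¬eo {n} s S = begin
  𝒫 ¬eo? (s ∷ S)  ≡⟨ 𝒫≡enumerate ¬eo? (s ∷ S) (p s) (to s) (from s) ⟩
  enumerate (p s)  ≡⟨ with-first s ⟩
  map (false ∷_) (unpairedSubsets S) ++ (if s then map (true ∷_) (unpairedSubsets S) else []) ∎
  where
  p : Bool → Subset (suc n) → Bool
  p s (false ∷ B) = unpairedIn S B
  p s (true  ∷ B) = s ∧ unpairedIn S B
  to : ∀ s B → B ⊆ s ∷ S → ¬eo B → T (p s B)
  to s (false ∷ B) B⊆S h = ⇒unpairedIn S B (drop-∷-⊆ B⊆S) (¬eo⇒Unpaired false B h)
  to s (true  ∷ B) B⊆S h with refl ← ⊆-∷⁻ B⊆S refl = ⇒unpairedIn S B (drop-∷-⊆ B⊆S) (¬eo⇒Unpaired true B h)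
  from : ∀ s B → T (p s B) → B ⊆ s ∷ S × ¬eo B
  from s    (false ∷ B) h with B⊆S , uB ← unpairedIn⇒ S B h = out⊆ B⊆S , Unpaired⇒¬eo false B uB
  from true (true  ∷ B) h with B⊆S , uB ← unpairedIn⇒ S B h = s⊆s B⊆S , Unpaired⇒¬eo true B uB
  with-first : ∀ s → enumerate (p s) ≡
    map (false ∷_) (unpairedSubsets S) ++ (if s then map (true ∷_) (unpairedSubsets S) else [])
  with-first true  = enumerate-∷ (p true) (enumerate-unpaired S) (enumerate-unpaired S)
  with-first false = enumerate-∷ (p false) (enumerate-unpaired S) none

-- The sums over subsets in the recursion

-- The second argument of `h` is the exponent of t. The lower bounds on #A + #B and the factors x^k
-- and z_k are left to `h`, so that one kind of sum over all pairs serves the whole recursion.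
signedSum : (c : List ℕ) → List (Subset (length c)) → List (Subset (length c)) → (List ℕ → ℕ → ℤ) → ℤ
signedSum c 𝒜 ℬ h = sumOver 𝒜 λ A → sumOver ℬ λ B →
  (-1ℤ ℤ.^ ∣ B ∣) ℤ.* h (c ₍₋ A ₎−δ B) (∣ A ∣ ℕ.+ ∣ B ∣)

eoSum oeSum : List ℕ → (List ℕ → ℕ → ℤ) → ℤ
eoSum c = signedSum c (𝒫 eo? (ones c)) (𝒫 ¬eo? (larges c))
oeSum c = signedSum c (𝒫 oe? (ones c)) (𝒫 ¬oe? (larges c))

blockSum : List ℕ → (List ℕ → ℕ → ℤ) → ℤ
blockSum c = signedSum c (pairedSubsets (ones c)) (unpairedSubsets (larges c))

oeSum≡blockSum : ∀ c h → oeSum c h ≡ blockSum c h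
oeSum≡blockSum c h = cong₂ (λ 𝒜 ℬ → signedSum c 𝒜 ℬ h) (𝒫-oe (ones c)) (𝒫-¬oe (larges c))

module _ (c : List ℕ) (𝒜 : List (Subset (length c))) where

  signedSum-++ˡ : ∀ 𝒜′ ℬ h → signedSum c (𝒜 ++ 𝒜′) ℬ h ≡ signedSum c 𝒜 ℬ h ℤ.+ signedSum c 𝒜′ ℬ h
  signedSum-++ˡ 𝒜′ ℬ h = sumOver-++ 𝒜 𝒜′ _

  signedSum-++ʳ : ∀ ℬ ℬ′ h → signedSum c 𝒜 (ℬ ++ ℬ′) h ≡ signedSum c 𝒜 ℬ h ℤ.+ signedSum c 𝒜 ℬ′ h
  signedSum-++ʳ ℬ ℬ′ h = trans (sumOver-cong 𝒜 λ A → sumOver-++ ℬ ℬ′ _) (sumOver-+ 𝒜 _ _)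

  signedSum-map : ∀ {c′} (f g : Subset (length c) → Subset (length c′)) ℬ (h h′ : List ℕ → ℕ → ℤ) →
    (∀ A B → (-1ℤ ℤ.^ ∣ g B ∣) ℤ.* h (c′ ₍₋ f A ₎−δ g B) (∣ f A ∣ ℕ.+ ∣ g B ∣) ≡
             (-1ℤ ℤ.^ ∣ B ∣) ℤ.* h′ (c ₍₋ A ₎−δ B) (∣ A ∣ ℕ.+ ∣ B ∣)) →
    signedSum c′ (map f 𝒜) (map g ℬ) h ≡ signedSum c 𝒜 ℬ h′
  signedSum-map f g ℬ h h′ eq = trans (sumOver-map f 𝒜 _)
    (sumOver-cong 𝒜 λ A → trans (sumOver-map g ℬ _) (sumOver-cong ℬ λ B → eq A B))

  -- For maps `g` that add one element to B: it costs a sign and removes one unit, which amounts to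
  -- a factor -t.
  signedSum-map-neg : ∀ {c′} (f g : Subset (length c) → Subset (length c′)) ℬ (h h′ : List ℕ → ℕ → ℤ) →
    (∀ A B → (-1ℤ ℤ.^ ∣ g B ∣) ℤ.* h (c′ ₍₋ f A ₎−δ g B) (∣ f A ∣ ℕ.+ ∣ g B ∣) ≡
             (-1ℤ ℤ.^ suc ∣ B ∣) ℤ.* h′ (c ₍₋ A ₎−δ B) (∣ A ∣ ℕ.+ suc ∣ B ∣)) →
    signedSum c′ (map f 𝒜) (map g ℬ) h ≡ ℤ.- signedSum c 𝒜 ℬ (λ c″ k → h′ c″ (suc k))
  signedSum-map-neg {c′} f g ℬ h h′ eq = begin
    signedSum c′ (map f 𝒜) (map g ℬ) h
      ≡⟨ sumOver-map f 𝒜 _ ⟩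
    (sumOver 𝒜 λ A → sumOver (map g ℬ) λ B → (-1ℤ ℤ.^ ∣ B ∣) ℤ.* h (c′ ₍₋ f A ₎−δ B) (∣ f A ∣ ℕ.+ ∣ B ∣))
      ≡⟨ (sumOver-cong 𝒜 λ A → trans (sumOver-map g ℬ _) (trans (sumOver-cong ℬ λ B → negate A B) (sumOver-neg ℬ _))) ⟩
    (sumOver 𝒜 λ A → ℤ.- sumOver ℬ λ B → (-1ℤ ℤ.^ ∣ B ∣) ℤ.* h′ (c ₍₋ A ₎−δ B) (suc (∣ A ∣ ℕ.+ ∣ B ∣)))
      ≡⟨ sumOver-neg 𝒜 _ ⟩
    ℤ.- signedSum c 𝒜 ℬ (λ c″ k → h′ c″ (suc k)) ∎
    where
    pull-sign : ∀ s t → -1ℤ ℤ.* s ℤ.* t ≡ ℤ.- (s ℤ.* t)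
    pull-sign s t = trans (ℤ.*-assoc -1ℤ s t) (ℤ.-1*i≡-i (s ℤ.* t))
    negate : ∀ A B → (-1ℤ ℤ.^ ∣ g B ∣) ℤ.* h (c′ ₍₋ f A ₎−δ g B) (∣ f A ∣ ℕ.+ ∣ g B ∣) ≡
                     ℤ.- ((-1ℤ ℤ.^ ∣ B ∣) ℤ.* h′ (c ₍₋ A ₎−δ B) (suc (∣ A ∣ ℕ.+ ∣ B ∣)))
    negate A B = trans (eq A B) (trans (pull-sign (-1ℤ ℤ.^ ∣ B ∣) (h′ (c ₍₋ A ₎−δ B) (∣ A ∣ ℕ.+ suc ∣ B ∣)))
      (cong (λ k → ℤ.- ((-1ℤ ℤ.^ ∣ B ∣) ℤ.* h′ (c ₍₋ A ₎−δ B) k)) (ℕ.+-suc ∣ A ∣ ∣ B ∣)))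

blockSum-[] : ∀ h → blockSum [] h ≡ h [] 0
blockSum-[] h = one (h [] 0)
  where
  one : ∀ a → 1ℤ ℤ.* a ℤ.+ 0ℤ ℤ.+ 0ℤ ≡ a
  one = solve-∀

blockSum-1 : ∀ h → blockSum (1 ∷ []) h ≡ h (1 ∷ []) 0
blockSum-1 h = one (h (1 ∷ []) 0)
  where
  one : ∀ a → 1ℤ ℤ.* a ℤ.+ 0ℤ ℤ.+ 0ℤ ≡ a
  one = solve-∀

blockSum-2 : ∀ h → blockSum (2 ∷ []) h ≡ h (2 ∷ []) 0 ℤ.- h (1 ∷ []) 1
blockSum-2 h = two (h (2 ∷ []) 0) (h (1 ∷ []) 1)
  where
  two : ∀ a b → 1ℤ ℤ.* a ℤ.+ (-1ℤ ℤ.* b ℤ.+ 0ℤ) ℤ.+ 0ℤ ≡ a ℤ.- b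
  two = solve-∀

module _ (c : List ℕ) (h : List ℕ → ℕ → ℤ) where

  private
    𝒜 = pairedSubsets (ones c)
    ℬ = unpairedSubsets (larges c)
    o i : Subset n → Subset (suc n)
    o = false ∷_
    i = true ∷_

  blockSum-11 : blockSum (1 ∷ 1 ∷ c) h ≡
    blockSum c (λ c′ → h (1 ∷ 1 ∷ c′)) ℤ.+ blockSum c (λ c′ k → h c′ (2 ℕ.+ k))
  blockSum-11 = trans (signedSum-++ˡ (1 ∷ 1 ∷ c) (map (o ∘ o) 𝒜) (map (i ∘ i) 𝒜) (map (o ∘ o) ℬ) h)
    (cong₂ ℤ._+_ (signedSum-map c 𝒜 {1 ∷ 1 ∷ c} (o ∘ o) (o ∘ o) ℬ h (λ c′ → h (1 ∷ 1 ∷ c′)) (λ A B → refl))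
                 (signedSum-map c 𝒜 {1 ∷ 1 ∷ c} (i ∘ i) (o ∘ o) ℬ h (λ c′ k → h c′ (2 ℕ.+ k)) (λ A B → refl)))

  blockSum-12 : blockSum (1 ∷ 2 ∷ c) h ≡
    blockSum c (λ c′ → h (1 ∷ 2 ∷ c′)) ℤ.- blockSum c (λ c′ k → h (1 ∷ 1 ∷ c′) (suc k))
  blockSum-12 = trans (signedSum-++ʳ (1 ∷ 2 ∷ c) (map (o ∘ o) 𝒜) (map (o ∘ o) ℬ) (map (o ∘ i) ℬ) h)
    (cong₂ ℤ._+_ (signedSum-map c 𝒜 {1 ∷ 2 ∷ c} (o ∘ o) (o ∘ o) ℬ h (λ c′ → h (1 ∷ 2 ∷ c′)) (λ A B → refl))
                 (signedSum-map-neg c 𝒜 {1 ∷ 2 ∷ c} (o ∘ o) (o ∘ i) ℬ h (λ c′ → h (1 ∷ 1 ∷ c′)) (λ A B → refl)))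

  blockSum-21 : blockSum (2 ∷ 1 ∷ c) h ≡
    blockSum c (λ c′ → h (2 ∷ 1 ∷ c′)) ℤ.- blockSum c (λ c′ k → h (1 ∷ 1 ∷ c′) (suc k))
  blockSum-21 = trans (signedSum-++ʳ (2 ∷ 1 ∷ c) (map (o ∘ o) 𝒜) (map (o ∘ o) ℬ) (map (i ∘ o) ℬ) h)
    (cong₂ ℤ._+_ (signedSum-map c 𝒜 {2 ∷ 1 ∷ c} (o ∘ o) (o ∘ o) ℬ h (λ c′ → h (2 ∷ 1 ∷ c′)) (λ A B → refl))
                 (signedSum-map-neg c 𝒜 {2 ∷ 1 ∷ c} (o ∘ o) (i ∘ o) ℬ h (λ c′ → h (1 ∷ 1 ∷ c′)) (λ A B → refl)))

  -- Two entries 2 share a block only where two letters `z₃` meet. Lowering both is forbidden, so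
  -- there is no term in t² here, in contrast to the product of two factors `z₃ - t z₂`.
  blockSum-22 : blockSum (2 ∷ 2 ∷ c) h ≡
    blockSum c (λ c′ → h (2 ∷ 2 ∷ c′)) ℤ.+
      (ℤ.- blockSum c (λ c′ k → h (2 ∷ 1 ∷ c′) (suc k)) ℤ.- blockSum c (λ c′ k → h (1 ∷ 2 ∷ c′) (suc k)))
  blockSum-22 = trans (signedSum-++ʳ (2 ∷ 2 ∷ c) (map (o ∘ o) 𝒜) (map (o ∘ o) ℬ) (map (o ∘ i) ℬ ++ map (i ∘ o) ℬ) h)
    (cong₂ ℤ._+_ (signedSum-map c 𝒜 {2 ∷ 2 ∷ c} (o ∘ o) (o ∘ o) ℬ h (λ c′ → h (2 ∷ 2 ∷ c′)) (λ A B → refl))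
      (trans (signedSum-++ʳ (2 ∷ 2 ∷ c) (map (o ∘ o) 𝒜) (map (o ∘ i) ℬ) (map (i ∘ o) ℬ) h)
        (cong₂ ℤ._+_ (signedSum-map-neg c 𝒜 {2 ∷ 2 ∷ c} (o ∘ o) (o ∘ i) ℬ h (λ c′ → h (2 ∷ 1 ∷ c′)) (λ A B → refl))
                     (signedSum-map-neg c 𝒜 {2 ∷ 2 ∷ c} (o ∘ o) (i ∘ o) ℬ h (λ c′ → h (1 ∷ 2 ∷ c′)) (λ A B → refl)))))

  eoSum-1 : eoSum (1 ∷ c) h ≡ blockSum c (λ c′ → h (1 ∷ c′))
  eoSum-1 = begin
    eoSum (1 ∷ c) h
      ≡⟨ cong₂ (λ 𝒜 ℬ → signedSum (1 ∷ c) 𝒜 ℬ h) (𝒫-eo true (ones c))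
           (trans (𝒫-¬eo false (larges c)) (List.++-identityʳ _)) ⟩
    signedSum (1 ∷ c) (map o 𝒜) (map o ℬ) h
      ≡⟨ signedSum-map c 𝒜 {1 ∷ c} o o ℬ h (λ c′ → h (1 ∷ c′)) (λ A B → refl) ⟩
    blockSum c (λ c′ → h (1 ∷ c′)) ∎

  eoSum-2 : eoSum (2 ∷ c) h ≡ blockSum c (λ c′ → h (2 ∷ c′)) ℤ.- blockSum c (λ c′ k → h (1 ∷ c′) (suc k))
  eoSum-2 = begin
    eoSum (2 ∷ c) h
      ≡⟨ cong₂ (λ 𝒜 ℬ → signedSum (2 ∷ c) 𝒜 ℬ h) (𝒫-eo false (ones c)) (𝒫-¬eo true (larges c)) ⟩
    signedSum (2 ∷ c) (map o 𝒜) (map o ℬ ++ map i ℬ) h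
      ≡⟨ signedSum-++ʳ (2 ∷ c) (map o 𝒜) (map o ℬ) (map i ℬ) h ⟩
    signedSum (2 ∷ c) (map o 𝒜) (map o ℬ) h ℤ.+ signedSum (2 ∷ c) (map o 𝒜) (map i ℬ) h
      ≡⟨ cong₂ ℤ._+_ (signedSum-map c 𝒜 {2 ∷ c} o o ℬ h (λ c′ → h (2 ∷ c′)) (λ A B → refl))
                     (signedSum-map-neg c 𝒜 {2 ∷ c} o i ℬ h (λ c′ → h (1 ∷ c′)) (λ A B → refl)) ⟩
    blockSum c (λ c′ → h (2 ∷ c′)) ℤ.- blockSum c (λ c′ k → h (1 ∷ c′) (suc k)) ∎

-- The recursion under a linear functional

infix 5 _if_≤_
_if_≤_ : ℤ → ℕ → ℕ → ℤ
a if m ≤ n = if does (m ℕ.≤? n) then a else 0ℤ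

if-*ˡ : ∀ b s a → (if b then s ℤ.* a else 0ℤ) ≡ s ℤ.* (if b then a else 0ℤ)
if-*ˡ true  s a = refl
if-*ˡ false s a = sym (ℤ.*-zeroʳ s)

eval-pairs : ∀ (φ : Word → ℤ) (F : List ℕ → ℋ) c m 𝒜 ℬ (s : ℕ → ℤ) (w : ℕ → Word) →
  eval φ (∑ (pairs m 𝒜 ℬ) λ (A , B) → s ∣ B ∣ · (F (c ₍₋ A ₎−δ B) * ⟦ w (∣ A ∣ ℕ.+ ∣ B ∣) ⟧)) ≡
  sumOver 𝒜 λ A → sumOver ℬ λ B → s ∣ B ∣ ℤ.*
    (eval (φ ▹ w (∣ A ∣ ℕ.+ ∣ B ∣)) (F (c ₍₋ A ₎−δ B)) if m ≤ ∣ A ∣ ℕ.+ ∣ B ∣)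
eval-pairs φ F c m 𝒜 ℬ s w = begin
  eval φ (∑ (pairs m 𝒜 ℬ) term)
    ≡⟨ eval-∑ φ (pairs m 𝒜 ℬ) term ⟩
  sumOver (pairs m 𝒜 ℬ) (eval φ ∘ term)
    ≡⟨ sumOver-filter (λ (A , B) → m ℕ.≤? ∣ A ∣ ℕ.+ ∣ B ∣) (cartesianProduct 𝒜 ℬ) (eval φ ∘ term) ⟩
  (sumOver (cartesianProduct 𝒜 ℬ) λ AB → eval φ (term AB) if m ≤ weight AB)
    ≡⟨ sumOver-cartesianProduct 𝒜 ℬ _ ⟩
  (sumOver 𝒜 λ A → sumOver ℬ λ B → eval φ (term (A , B)) if m ≤ weight (A , B))
    ≡⟨ (sumOver-cong 𝒜 λ A → sumOver-cong ℬ λ B → evaluate A B) ⟩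
  _ ∎
  where
  weight : Subset (length c) × Subset (length c) → ℕ
  weight (A , B) = ∣ A ∣ ℕ.+ ∣ B ∣
  term : Subset (length c) × Subset (length c) → ℋ
  term AB@(A , B) = s ∣ B ∣ · (F (c ₍₋ A ₎−δ B) * ⟦ w (weight AB) ⟧)
  evaluate : ∀ A B → (eval φ (term (A , B)) if m ≤ weight (A , B)) ≡ s ∣ B ∣ ℤ.*
    (eval (φ ▹ w (weight (A , B))) (F (c ₍₋ A ₎−δ B)) if m ≤ weight (A , B))
  evaluate A B = trans
    (cong (λ a → a if m ≤ weight (A , B)) (trans (eval-· φ (s ∣ B ∣) (F (c ₍₋ A ₎−δ B) * ⟦ w (weight (A , B)) ⟧))
      (cong (s ∣ B ∣ ℤ.*_) (eval-*⟦⟧ φ (F (c ₍₋ A ₎−δ B)) (w (weight (A , B)))))))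
    (if-*ˡ (does (m ℕ.≤? weight (A , B))) (s ∣ B ∣) _)

module _ (φ : Word → ℤ) (F : List ℕ → ℋ) where

  xTerm zTerm : List ℕ → ℕ → ℤ
  xTerm c k = eval (φ ▹ replicate k x) (F c) if 1 ≤ k
  zTerm c k = eval (φ ▹ z k) (F c) if 2 ≤ k

  eval-step : ∀ c → eval φ (step F c) ≡ ℤ.- eoSum c xTerm ℤ.- eoSum c zTerm ℤ.+ oeSum c zTerm
  eval-step c = trans (eval-+ φ (p₁ + p₂) p₃) (cong₂ ℤ._+_ (trans (eval-+ φ p₁ p₂) (cong₂ ℤ._+_
      (trans (eval-pairs φ F c 1 𝒜 ℬ (λ k → -1ℤ ℤ.^ suc k) (λ k → replicate k x)) (pull-sign xTerm))
      (trans (eval-pairs φ F c 2 𝒜 ℬ (λ k → -1ℤ ℤ.^ suc k) z) (pull-sign zTerm))))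
      (eval-pairs φ F c 2 (𝒫 oe? (ones c)) (𝒫 ¬oe? (larges c)) (-1ℤ ℤ.^_) z))
    where
    𝒜 = 𝒫 eo? (ones c)
    ℬ = 𝒫 ¬eo? (larges c)
    p₁ = ∑ (pairs 1 𝒜 ℬ)
      λ (A , B) → (-1ℤ ℤ.^ suc ∣ B ∣) · (F (c ₍₋ A ₎−δ B) * ⟦ replicate (∣ A ∣ ℕ.+ ∣ B ∣) x ⟧)
    p₂ = ∑ (pairs 2 𝒜 ℬ)
      λ (A , B) → (-1ℤ ℤ.^ suc ∣ B ∣) · (F (c ₍₋ A ₎−δ B) * ⟦ z (∣ A ∣ ℕ.+ ∣ B ∣) ⟧)
    p₃ = ∑ (pairs 2 (𝒫 oe? (ones c)) (𝒫 ¬oe? (larges c)))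
      λ (A , B) → (-1ℤ ℤ.^ ∣ B ∣) · (F (c ₍₋ A ₎−δ B) * ⟦ z (∣ A ∣ ℕ.+ ∣ B ∣) ⟧)
    pull-sign : ∀ h → (sumOver 𝒜 λ A → sumOver ℬ λ B →
      (-1ℤ ℤ.^ suc ∣ B ∣) ℤ.* h (c ₍₋ A ₎−δ B) (∣ A ∣ ℕ.+ ∣ B ∣)) ≡ ℤ.- eoSum c h
    pull-sign h = trans (sumOver-cong 𝒜 λ A → trans (sumOver-cong ℬ λ B →
        trans (ℤ.*-assoc -1ℤ (-1ℤ ℤ.^ ∣ B ∣) (h (c ₍₋ A ₎−δ B) (∣ A ∣ ℕ.+ ∣ B ∣))) (ℤ.-1*i≡-i _)) (sumOver-neg ℬ _))
      (sumOver-neg 𝒜 _)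

exponent : Gen → ℕ
exponent z₂ = 1
exponent z₃ = 2

-- Words of the form w₁ τ(w₂)

-- The exponents of the words z_{a₁} ⋯ z_{aᵣ} = y x^{a₁-1} ⋯ y x^{aᵣ-1} and
-- τ(z_{aᵣ} ⋯ z_{a₁}) = y^{a₁-1} x ⋯ y^{aᵣ-1} x.
codeˡ codeʳ : List Gen → List ℕ
codeˡ []      = []
codeˡ (g ∷ w) = 1 ∷ exponent g ∷ codeˡ w
codeʳ []      = []
codeʳ (g ∷ w) = exponent g ∷ 1 ∷ codeʳ w

-- v is the second word read backwards.
code : List Gen → List Gen → List ℕ
code u v = codeˡ u ++ codeʳ v

-- Moving the block boundaries by one position turns the blocks `(1 , e)` of the first word into
-- blocks `(e , 1)`; this is how the eo-sum sees them.
codeˡ-shift : ∀ u c → codeˡ u ++ 1 ∷ c ≡ 1 ∷ codeʳ u ++ c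
codeˡ-shift []      c = refl
codeˡ-shift (g ∷ u) c = cong (λ d → 1 ∷ exponent g ∷ d) (codeˡ-shift u c)

codeˡ-∷ʳ : ∀ u a c → codeˡ (u ∷ʳ a) ++ c ≡ 1 ∷ codeʳ u ++ exponent a ∷ c
codeˡ-∷ʳ []      a c = refl
codeˡ-∷ʳ (g ∷ u) a c = cong (λ d → 1 ∷ exponent g ∷ d) (codeˡ-∷ʳ u a c)

-- Weighted k, a word u carries t^k u; δSum w g is g applied to the image of w
-- under the ring homomorphism z₂ ↦ z₂ + t², z₃ ↦ z₃ - t z₂.
δSum : List Gen → (List Gen → ℕ → ℤ) → ℤ
δSum []       g = g [] 0
δSum (z₂ ∷ w) g = δSum w (λ u → g (z₂ ∷ u)) ℤ.+ δSum w (λ u k → g u (2 ℕ.+ k))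
δSum (z₃ ∷ w) g = δSum w (λ u → g (z₃ ∷ u)) ℤ.- δSum w (λ u k → g (z₂ ∷ u) (suc k))

-- The degree in x and y. With t of degree 1, both `z₂ + t²` and `z₃ - t z₂` are homogeneous.
size : List Gen → ℕ
size []      = 0
size (g ∷ w) = suc (exponent g) ℕ.+ size w

+-left-comm : ∀ k j l → k ℕ.+ (j ℕ.+ l) ≡ j ℕ.+ (k ℕ.+ l)
+-left-comm = ℕ-solve

size-∷ʳ : ∀ u a → size (u ∷ʳ a) ≡ size (a ∷ u)
size-∷ʳ []      a = refl
size-∷ʳ (g ∷ u) a = trans (cong (suc (exponent g) ℕ.+_) (size-∷ʳ u a))
  (+-left-comm (suc (exponent g)) (suc (exponent a)) (size u))

-- By homogeneity only arguments with `size u + k = size w` occur. This restriction is what lets an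
-- induction hypothesis about smaller degrees be used under the sum.
δSum-cong : ∀ w {g g′} → (∀ u k → size u ℕ.+ k ≡ size w → g u k ≡ g′ u k) → δSum w g ≡ δSum w g′
δSum-cong []       h = h [] 0 refl
δSum-cong (z₂ ∷ w) h = cong₂ ℤ._+_
  (δSum-cong w λ u k e → h (z₂ ∷ u) k (cong (2 ℕ.+_) e))
  (δSum-cong w λ u k e → h u (2 ℕ.+ k) (trans (+-left-comm (size u) 2 k) (cong (2 ℕ.+_) e)))
δSum-cong (z₃ ∷ w) h = cong₂ ℤ._-_
  (δSum-cong w λ u k e → h (z₃ ∷ u) k (cong (3 ℕ.+_) e))
  (δSum-cong w λ u k e → h (z₂ ∷ u) (suc k) (cong (2 ℕ.+_) (trans (ℕ.+-suc (size u) k) (cong suc e))))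

δSum-ext : ∀ w {g g′} → (∀ u k → g u k ≡ g′ u k) → δSum w g ≡ δSum w g′
δSum-ext w h = δSum-cong w λ u k _ → h u k

δSum-+ : ∀ w g g′ → δSum w (λ u k → g u k ℤ.+ g′ u k) ≡ δSum w g ℤ.+ δSum w g′
δSum-+ []       g g′ = refl
δSum-+ (z₂ ∷ w) g g′ = trans (cong₂ ℤ._+_ (δSum-+ w _ _) (δSum-+ w _ _))
  (interchange (δSum w λ u → g (z₂ ∷ u)) (δSum w λ u → g′ (z₂ ∷ u)) _ _)
δSum-+ (z₃ ∷ w) g g′ = trans (cong₂ ℤ._-_ (δSum-+ w _ _) (δSum-+ w _ _))
  (interchange-- (δSum w λ u → g (z₃ ∷ u)) (δSum w λ u → g′ (z₃ ∷ u)) _ _)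

δSum-neg : ∀ w g → δSum w (λ u k → ℤ.- g u k) ≡ ℤ.- δSum w g
δSum-neg []       g = refl
δSum-neg (z₂ ∷ w) g = trans (cong₂ ℤ._+_ (δSum-neg w _) (δSum-neg w _)) (sym (ℤ.neg-distrib-+ (δSum w _) _))
δSum-neg (z₃ ∷ w) g = trans (cong₂ ℤ._-_ (δSum-neg w _) (δSum-neg w _)) (sym (ℤ.neg-distrib-+ (δSum w _) _))

δSum-- : ∀ w g g′ → δSum w (λ u k → g u k ℤ.- g′ u k) ≡ δSum w g ℤ.- δSum w g′
δSum-- w g g′ = trans (δSum-+ w g _) (cong (λ t → δSum w g ℤ.+ t) (δSum-neg w g′))

-- At t = 0 the substitution is the identity, so a function that vanishes on all positive powers of
-- t sees only `w` itself.
δSum-const : ∀ w {g} → (∀ u k → g u (suc k) ≡ 0ℤ) → δSum w g ≡ g w 0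
δSum-const []       h = refl
δSum-const (z₂ ∷ w) {g} h = begin
  δSum w (λ u → g (z₂ ∷ u)) ℤ.+ δSum w (λ u k → g u (2 ℕ.+ k))
    ≡⟨ cong₂ ℤ._+_ (δSum-const w λ u → h (z₂ ∷ u)) (δSum-const w λ u k → h u (2 ℕ.+ k)) ⟩
  g (z₂ ∷ w) 0 ℤ.+ g w 2  ≡⟨ cong (λ t → g (z₂ ∷ w) 0 ℤ.+ t) (h w 1) ⟩
  g (z₂ ∷ w) 0 ℤ.+ 0ℤ     ≡⟨ ℤ.+-identityʳ _ ⟩
  g (z₂ ∷ w) 0            ∎
δSum-const (z₃ ∷ w) {g} h = begin
  δSum w (λ u → g (z₃ ∷ u)) ℤ.- δSum w (λ u k → g (z₂ ∷ u) (suc k))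
    ≡⟨ cong₂ ℤ._-_ (δSum-const w λ u → h (z₃ ∷ u)) (δSum-const w λ u k → h (z₂ ∷ u) (suc k)) ⟩
  g (z₃ ∷ w) 0 ℤ.- g (z₂ ∷ w) 1  ≡⟨ cong (λ t → g (z₃ ∷ w) 0 ℤ.- t) (h (z₂ ∷ w) 0) ⟩
  g (z₃ ∷ w) 0 ℤ.- 0ℤ            ≡⟨ ℤ.+-identityʳ _ ⟩
  g (z₃ ∷ w) 0                   ∎

-- Multiplication by the image of one letter, on the right or on the left, transposed to functions.
-- Multiplicativity of the substitution then allows a letter to be split off at the end where the
-- two words meet.
appendδ prependδ : Gen → (List Gen → ℕ → ℤ) → List Gen → ℕ → ℤ
appendδ z₂ g u k = g (u ∷ʳ z₂) k ℤ.+ g u (2 ℕ.+ k)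
appendδ z₃ g u k = g (u ∷ʳ z₃) k ℤ.- g (u ∷ʳ z₂) (suc k)
prependδ z₂ g u k = g (z₂ ∷ u) k ℤ.+ g u (2 ℕ.+ k)
prependδ z₃ g u k = g (z₃ ∷ u) k ℤ.- g (z₂ ∷ u) (suc k)

δSum-∷ : ∀ a w g → δSum (a ∷ w) g ≡ δSum w (prependδ a g)
δSum-∷ z₂ w g = sym (δSum-+ w _ _)
δSum-∷ z₃ w g = sym (δSum-- w _ _)

δSum-∷ʳ : ∀ w a g → δSum (w ∷ʳ a) g ≡ δSum w (appendδ a g)
δSum-∷ʳ []       z₂ g = refl
δSum-∷ʳ []       z₃ g = refl
δSum-∷ʳ (z₂ ∷ w) z₂ g = cong₂ ℤ._+_ (δSum-∷ʳ w z₂ _) (δSum-∷ʳ w z₂ _)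
δSum-∷ʳ (z₂ ∷ w) z₃ g = cong₂ ℤ._+_ (δSum-∷ʳ w z₃ _) (δSum-∷ʳ w z₃ _)
δSum-∷ʳ (z₃ ∷ w) z₂ g = cong₂ ℤ._-_ (δSum-∷ʳ w z₂ _) (δSum-∷ʳ w z₂ _)
δSum-∷ʳ (z₃ ∷ w) z₃ g = cong₂ ℤ._-_ (δSum-∷ʳ w z₃ _) (δSum-∷ʳ w z₃ _)

-- A block `(1 , 1)` is either kept or deleted whole, which gives `z₂ + t²`; in `(1 , 2)` only the 2
-- can be lowered, which gives `z₃ - t z₂`.
blockSum-codeˡ : ∀ u c h → blockSum (codeˡ u ++ c) h ≡
  δSum u λ u′ k → blockSum c λ c′ l → h (codeˡ u′ ++ c′) (k ℕ.+ l)
blockSum-codeˡ []       c h = refl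
blockSum-codeˡ (z₂ ∷ u) c h = trans (blockSum-11 (codeˡ u ++ c) h)
  (cong₂ ℤ._+_ (blockSum-codeˡ u c λ c′ → h (1 ∷ 1 ∷ c′)) (blockSum-codeˡ u c λ c′ k → h c′ (2 ℕ.+ k)))
blockSum-codeˡ (z₃ ∷ u) c h = trans (blockSum-12 (codeˡ u ++ c) h)
  (cong₂ ℤ._-_ (blockSum-codeˡ u c λ c′ → h (1 ∷ 2 ∷ c′)) (blockSum-codeˡ u c λ c′ k → h (1 ∷ 1 ∷ c′) (suc k)))

blockSum-codeʳ : ∀ u c h → blockSum (codeʳ u ++ c) h ≡
  δSum u λ u′ k → blockSum c λ c′ l → h (codeʳ u′ ++ c′) (k ℕ.+ l)
blockSum-codeʳ []       c h = refl
blockSum-codeʳ (z₂ ∷ u) c h = trans (blockSum-11 (codeʳ u ++ c) h)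
  (cong₂ ℤ._+_ (blockSum-codeʳ u c λ c′ → h (1 ∷ 1 ∷ c′)) (blockSum-codeʳ u c λ c′ k → h c′ (2 ℕ.+ k)))
blockSum-codeʳ (z₃ ∷ u) c h = trans (blockSum-21 (codeʳ u ++ c) h)
  (cong₂ ℤ._-_ (blockSum-codeʳ u c λ c′ → h (2 ∷ 1 ∷ c′)) (blockSum-codeʳ u c λ c′ k → h (1 ∷ 1 ∷ c′) (suc k)))

blockSum-codeˡ-1 : ∀ u h → blockSum (codeˡ u ++ [ 1 ]) h ≡ δSum u λ u′ → h (codeˡ u′ ++ [ 1 ])
blockSum-codeˡ-1 u h = trans (blockSum-codeˡ u [ 1 ] h) (δSum-ext u λ u′ k →
  trans (blockSum-1 (λ c l → h (codeˡ u′ ++ c) (k ℕ.+ l))) (cong (h (codeˡ u′ ++ [ 1 ])) (ℕ.+-identityʳ k)))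

blockSum-codeʳ-[] : ∀ u h → blockSum (codeʳ u) h ≡ δSum u λ u′ → h (codeʳ u′)
blockSum-codeʳ-[] u h = begin
  blockSum (codeʳ u) h        ≡⟨ cong (λ c → blockSum c h) (List.++-identityʳ (codeʳ u)) ⟨
  blockSum (codeʳ u ++ []) h  ≡⟨ blockSum-codeʳ u [] h ⟩
  (δSum u λ u′ k → blockSum [] λ c l → h (codeʳ u′ ++ c) (k ℕ.+ l))
    ≡⟨ (δSum-ext u λ u′ k → trans (blockSum-[] (λ c l → h (codeʳ u′ ++ c) (k ℕ.+ l)))
         (cong₂ h (List.++-identityʳ (codeʳ u′)) (ℕ.+-identityʳ k))) ⟩
  (δSum u λ u′ → h (codeʳ u′)) ∎

-- The substitution on pairs of words, and the junction

Word²Fun : Set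
Word²Fun = List Gen → List Gen → ℕ → ℤ

δδSum : List Gen → List Gen → Word²Fun → ℤ
δδSum u v M = δSum u λ u′ k → δSum v λ v′ l → M u′ v′ (k ℕ.+ l)

oeSum-code : ∀ u v h → oeSum (code u v) h ≡ δδSum u v (λ u′ v′ → h (code u′ v′))
oeSum-code u v h = trans (oeSum≡blockSum (code u v) h) (trans (blockSum-codeˡ u (codeʳ v) h)
  (δSum-ext u λ u′ k → blockSum-codeʳ-[] v (λ c l → h (codeˡ u′ ++ c) (k ℕ.+ l))))

δδSum-cong : ∀ u v {G G′} →
  (∀ u′ v′ k → size u′ ℕ.+ (size v′ ℕ.+ k) ≡ size u ℕ.+ size v → G u′ v′ k ≡ G′ u′ v′ k) →
  δδSum u v G ≡ δδSum u v G′
δδSum-cong u v h = δSum-cong u λ u′ k eᵤ → δSum-cong v λ v′ l eᵥ →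
  h u′ v′ (k ℕ.+ l) (trans (regroup (size u′) (size v′) k l) (cong₂ ℕ._+_ eᵤ eᵥ))
  where
  regroup : ∀ a b k l → a ℕ.+ (b ℕ.+ (k ℕ.+ l)) ≡ a ℕ.+ k ℕ.+ (b ℕ.+ l)
  regroup = ℕ-solve

δδSum-ext : ∀ u v {G G′} → (∀ u′ v′ k → G u′ v′ k ≡ G′ u′ v′ k) → δδSum u v G ≡ δδSum u v G′
δδSum-ext u v h = δδSum-cong u v λ u′ v′ k _ → h u′ v′ k

δδSum-+ : ∀ u v G G′ → δδSum u v (λ u′ v′ k → G u′ v′ k ℤ.+ G′ u′ v′ k) ≡ δδSum u v G ℤ.+ δδSum u v G′
δδSum-+ u v G G′ = trans (δSum-ext u λ u′ k → δSum-+ v _ _) (δSum-+ u _ _)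

δδSum-const : ∀ u v {G} → (∀ u′ v′ k → G u′ v′ (suc k) ≡ 0ℤ) → δδSum u v G ≡ G u v 0
δδSum-const u v {G} h = trans (δSum-ext u λ u′ k → δSum-const v λ v′ l →
    trans (cong (G u′ v′) (ℕ.+-suc k l)) (h u′ v′ (k ℕ.+ l)))
  (δSum-const u λ u′ k → h u′ v (k ℕ.+ 0))

appendδ-ext : ∀ a {g g′} u k → (∀ u k → g u k ≡ g′ u k) → appendδ a g u k ≡ appendδ a g′ u k
appendδ-ext z₂ u k h = cong₂ ℤ._+_ (h _ _) (h _ _)
appendδ-ext z₃ u k h = cong₂ ℤ._-_ (h _ _) (h _ _)

prependδ-shift : ∀ b g k v l → prependδ b (λ v l → g v (k ℕ.+ l)) v l ≡ prependδ b g v (k ℕ.+ l)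
prependδ-shift z₂ g k v l = cong (λ m → g (z₂ ∷ v) (k ℕ.+ l) ℤ.+ g v m) (+-left-comm k 2 l)
prependδ-shift z₃ g k v l = cong (λ m → g (z₃ ∷ v) (k ℕ.+ l) ℤ.- g (z₂ ∷ v) m) (+-left-comm k 1 l)

appendδ-δSum : ∀ a v (G : Word²Fun) u k →
  appendδ a (λ u k → δSum v λ v l → G u v (k ℕ.+ l)) u k ≡
  δSum v λ v l → appendδ a (λ u → G u v) u (k ℕ.+ l)
appendδ-δSum z₂ v G u k = sym (δSum-+ v _ _)
appendδ-δSum z₃ v G u k = sym (δSum-- v _ _)

δδSum-ends : ∀ u a b v G → δδSum (u ∷ʳ a) (b ∷ v) G ≡
  δδSum u v λ u′ v′ → appendδ a (λ u″ → prependδ b (G u″) v′) u′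
δδSum-ends u a b v G = trans (δSum-∷ʳ u a _) (δSum-ext u λ u′ k → trans
  (appendδ-ext a u′ k λ u″ k′ → trans (δSum-∷ b v _) (δSum-ext v λ v′ l → prependδ-shift b (G u″) k′ v′ l))
  (appendδ-δSum a v (λ u″ v′ → prependδ b (G u″) v′) u′ k))

codeʳ-∷ : ∀ b v → codeʳ (b ∷ v) ≡ exponent b ∷ codeˡ v ++ [ 1 ]
codeʳ-∷ b v = cong (exponent b ∷_)
  (sym (trans (codeˡ-shift v []) (cong (1 ∷_) (List.++-identityʳ (codeʳ v)))))

code-seam : ∀ u a b v →
  1 ∷ codeʳ u ++ exponent a ∷ exponent b ∷ codeˡ v ++ [ 1 ] ≡ code (u ∷ʳ a) (b ∷ v)
code-seam u a b v = trans (cong (λ c → 1 ∷ codeʳ u ++ exponent a ∷ c) (sym (codeʳ-∷ b v)))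
  (sym (codeˡ-∷ʳ u a (codeʳ (b ∷ v))))

-- When the two ones at the junction are deleted, the ones on either side of them become neighbours
-- and form a new `z₂`. It could be given to either word; here the first word receives it.
code-seam-z₂ : ∀ u v → 1 ∷ codeʳ u ++ codeˡ v ++ [ 1 ] ≡ code (u ∷ʳ z₂) v
code-seam-z₂ u v = trans
  (cong (λ c → 1 ∷ codeʳ u ++ c) (trans (codeˡ-shift v []) (cong (1 ∷_) (List.++-identityʳ (codeʳ v)))))
  (sym (codeˡ-∷ʳ u z₂ (codeʳ v)))

-- The contribution of the positions where the two words meet to the sum over
-- 𝒫ᵉᵒ and 𝒫^¬ᵉᵒ; all the other letters contribute to it as in δSum.
seamδ : Gen → Gen → Word²Fun → Word²Fun
seamδ z₂ z₂ G u v k = G (u ∷ʳ z₂) (z₂ ∷ v) k ℤ.+ G (u ∷ʳ z₂) v (2 ℕ.+ k)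
seamδ z₂ z₃ G u v k = G (u ∷ʳ z₂) (z₃ ∷ v) k ℤ.- G (u ∷ʳ z₂) (z₂ ∷ v) (suc k)
seamδ z₃ z₂ G u v k = G (u ∷ʳ z₃) (z₂ ∷ v) k ℤ.- G (u ∷ʳ z₂) (z₂ ∷ v) (suc k)
seamδ z₃ z₃ G u v k = G (u ∷ʳ z₃) (z₃ ∷ v) k ℤ.+
  (ℤ.- G (u ∷ʳ z₃) (z₂ ∷ v) (suc k) ℤ.- G (u ∷ʳ z₂) (z₃ ∷ v) (suc k))

-- If the other word is empty, the entry at the junction is the last or the first of the tuple and
-- has no eo-partner. A 2 may still be lowered, but a 1 cannot be deleted, so the t² of `z₂ + t²` is
-- lost.
lastδ firstδ : Gen → (List Gen → ℕ → ℤ) → List Gen → ℕ → ℤ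
lastδ z₂ g u k = g (u ∷ʳ z₂) k
lastδ z₃ g u k = g (u ∷ʳ z₃) k ℤ.- g (u ∷ʳ z₂) (suc k)
firstδ z₂ g v k = g (z₂ ∷ v) k
firstδ z₃ g v k = g (z₃ ∷ v) k ℤ.- g (z₂ ∷ v) (suc k)

module _ (h : List ℕ → ℕ → ℤ) where

  private
    H : Word²Fun
    H u v = h (code u v)

  eoSum-seam : ∀ u a b v → eoSum (code (u ∷ʳ a) (b ∷ v)) h ≡ δδSum u v (seamδ a b H)
  eoSum-seam u a b v = begin
    eoSum (code (u ∷ʳ a) (b ∷ v)) h
      ≡⟨ cong (λ c → eoSum c h) (code-seam u a b v) ⟨
    eoSum (1 ∷ codeʳ u ++ exponent a ∷ exponent b ∷ codeˡ v ++ [ 1 ]) h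
      ≡⟨ eoSum-1 (codeʳ u ++ exponent a ∷ exponent b ∷ codeˡ v ++ [ 1 ]) h ⟩
    blockSum (codeʳ u ++ exponent a ∷ exponent b ∷ codeˡ v ++ [ 1 ]) (λ c → h (1 ∷ c))
      ≡⟨ blockSum-codeʳ u (exponent a ∷ exponent b ∷ codeˡ v ++ [ 1 ]) (λ c → h (1 ∷ c)) ⟩
    (δSum u λ u′ k → blockSum (exponent a ∷ exponent b ∷ codeˡ v ++ [ 1 ]) (λ c l → h (1 ∷ codeʳ u′ ++ c) (k ℕ.+ l)))
      ≡⟨ (δSum-ext u λ u′ k → meet a b u′ k) ⟩
    δδSum u v (seamδ a b H) ∎
    where
    -- `j` counts the units removed inside the junction block.
    kept : ∀ j a b u′ k →
      blockSum (codeˡ v ++ [ 1 ]) (λ c l → h (1 ∷ codeʳ u′ ++ exponent a ∷ exponent b ∷ c) (k ℕ.+ (j ℕ.+ l))) ≡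
      δSum v λ v′ l → H (u′ ∷ʳ a) (b ∷ v′) (j ℕ.+ (k ℕ.+ l))
    kept j a b u′ k = trans
      (blockSum-codeˡ-1 v (λ c l → h (1 ∷ codeʳ u′ ++ exponent a ∷ exponent b ∷ c) (k ℕ.+ (j ℕ.+ l))))
      (δSum-ext v λ v′ l → cong₂ h (code-seam u′ a b v′) (+-left-comm k j l))
    dropped : ∀ u′ k → blockSum (codeˡ v ++ [ 1 ]) (λ c l → h (1 ∷ codeʳ u′ ++ c) (k ℕ.+ (2 ℕ.+ l))) ≡
      δSum v λ v′ l → H (u′ ∷ʳ z₂) v′ (2 ℕ.+ (k ℕ.+ l))
    dropped u′ k = trans
      (blockSum-codeˡ-1 v (λ c l → h (1 ∷ codeʳ u′ ++ c) (k ℕ.+ (2 ℕ.+ l))))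
      (δSum-ext v λ v′ l → cong₂ h (code-seam-z₂ u′ v′) (+-left-comm k 2 l))
    meet : ∀ a b u′ k →
      blockSum (exponent a ∷ exponent b ∷ codeˡ v ++ [ 1 ]) (λ c l → h (1 ∷ codeʳ u′ ++ c) (k ℕ.+ l)) ≡
      δSum v λ v′ l → seamδ a b H u′ v′ (k ℕ.+ l)
    meet z₂ z₂ u′ k = trans (blockSum-11 (codeˡ v ++ [ 1 ]) λ c l → h (1 ∷ codeʳ u′ ++ c) (k ℕ.+ l))
      (trans (cong₂ ℤ._+_ (kept 0 z₂ z₂ u′ k) (dropped u′ k)) (sym (δSum-+ v _ _)))
    meet z₂ z₃ u′ k = trans (blockSum-12 (codeˡ v ++ [ 1 ]) λ c l → h (1 ∷ codeʳ u′ ++ c) (k ℕ.+ l))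
      (trans (cong₂ ℤ._-_ (kept 0 z₂ z₃ u′ k) (kept 1 z₂ z₂ u′ k)) (sym (δSum-- v _ _)))
    meet z₃ z₂ u′ k = trans (blockSum-21 (codeˡ v ++ [ 1 ]) λ c l → h (1 ∷ codeʳ u′ ++ c) (k ℕ.+ l))
      (trans (cong₂ ℤ._-_ (kept 0 z₃ z₂ u′ k) (kept 1 z₂ z₂ u′ k)) (sym (δSum-- v _ _)))
    meet z₃ z₃ u′ k = trans (blockSum-22 (codeˡ v ++ [ 1 ]) λ c l → h (1 ∷ codeʳ u′ ++ c) (k ℕ.+ l))
      (trans (cong₂ ℤ._+_ (kept 0 z₃ z₃ u′ k) (cong₂ (λ s t → ℤ.- s ℤ.- t) (kept 1 z₃ z₂ u′ k) (kept 1 z₂ z₃ u′ k)))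
        (sym (trans (δSum-+ v _ _) (cong (λ t → δSum v (λ v′ l → H (u′ ∷ʳ z₃) (z₃ ∷ v′) (k ℕ.+ l)) ℤ.+ t)
          (trans (δSum-- v _ _) (cong (λ t → t ℤ.- δSum v (λ v′ l → H (u′ ∷ʳ z₂) (z₃ ∷ v′) (suc (k ℕ.+ l))))
            (δSum-neg v _)))))))

  eoSum-last : ∀ u a → eoSum (code (u ∷ʳ a) []) h ≡ δSum u (lastδ a λ u′ → H u′ [])
  eoSum-last u a = begin
    eoSum (code (u ∷ʳ a) []) h
      ≡⟨ cong (λ c → eoSum c h) (codeˡ-∷ʳ u a []) ⟩
    eoSum (1 ∷ codeʳ u ++ [ exponent a ]) h
      ≡⟨ eoSum-1 (codeʳ u ++ [ exponent a ]) h ⟩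
    blockSum (codeʳ u ++ [ exponent a ]) (λ c → h (1 ∷ c))
      ≡⟨ blockSum-codeʳ u [ exponent a ] (λ c → h (1 ∷ c)) ⟩
    (δSum u λ u′ k → blockSum [ exponent a ] (λ c l → h (1 ∷ codeʳ u′ ++ c) (k ℕ.+ l)))
      ≡⟨ (δSum-ext u λ u′ k → end a u′ k) ⟩
    δSum u (lastδ a λ u′ → H u′ []) ∎
    where
    kept : ∀ a u′ k j → h (1 ∷ codeʳ u′ ++ [ exponent a ]) (k ℕ.+ j) ≡ H (u′ ∷ʳ a) [] (j ℕ.+ k)
    kept a u′ k j = cong₂ h (sym (codeˡ-∷ʳ u′ a [])) (ℕ.+-comm k j)
    end : ∀ a u′ k → blockSum [ exponent a ] (λ c l → h (1 ∷ codeʳ u′ ++ c) (k ℕ.+ l)) ≡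
          lastδ a (λ u′ → H u′ []) u′ k
    end z₂ u′ k = trans (blockSum-1 (λ c l → h (1 ∷ codeʳ u′ ++ c) (k ℕ.+ l))) (kept z₂ u′ k 0)
    end z₃ u′ k = trans (blockSum-2 (λ c l → h (1 ∷ codeʳ u′ ++ c) (k ℕ.+ l)))
      (cong₂ ℤ._-_ (kept z₃ u′ k 0) (kept z₂ u′ k 1))

  eoSum-first : ∀ b v → eoSum (code [] (b ∷ v)) h ≡ δSum v (firstδ b (H []))
  eoSum-first b v = trans (cong (λ c → eoSum c h) (codeʳ-∷ b v)) (start b)
    where
    kept : ∀ b j → blockSum (codeˡ v ++ [ 1 ]) (λ c l → h (exponent b ∷ c) (j ℕ.+ l)) ≡
           δSum v λ v′ l → H [] (b ∷ v′) (j ℕ.+ l)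
    kept b j = trans (blockSum-codeˡ-1 v (λ c l → h (exponent b ∷ c) (j ℕ.+ l)))
      (δSum-ext v λ v′ l → cong (λ c → h c (j ℕ.+ l)) (sym (codeʳ-∷ b v′)))
    start : ∀ b → eoSum (exponent b ∷ codeˡ v ++ [ 1 ]) h ≡ δSum v (firstδ b (H []))
    start z₂ = trans (eoSum-1 (codeˡ v ++ [ 1 ]) h) (kept z₂ 0)
    start z₃ = trans (eoSum-2 (codeˡ v ++ [ 1 ]) h)
      (trans (cong₂ ℤ._-_ (kept z₃ 0) (kept z₂ 1)) (sym (δSum-- v _ _)))

-- The product ⋆

genWords : List Gen → Word
genWords = concatMap genWord

genWords-++ : ∀ u v → genWords (u ++ v) ≡ genWords u ++ genWords v
genWords-++ u v = List.concatMap-++ genWord u v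

-- v is the second factor read backwards, as in code.
star : List Gen → List Gen → (Word → ℤ) → ℤ
star u v φ = eval (φ ∘ genWords) (u ⋆ʷ reverse v)

star-cong : ∀ u v {φ ψ} → (∀ w → φ w ≡ ψ w) → star u v φ ≡ star u v ψ
star-cong u v h = eval-cong (u ⋆ʷ reverse v) λ w → h (genWords w)

eval-genWords-* : ∀ φ p v → eval (φ ∘ genWords) (p * ⟦ v ⟧) ≡ eval ((φ ▹ genWords v) ∘ genWords) p
eval-genWords-* φ p v = trans (eval-*⟦⟧ (φ ∘ genWords) p v) (eval-cong p λ w → cong φ (genWords-++ w v))

star-[]ʳ : ∀ u φ → star u [] φ ≡ φ (genWords u)
star-[]ʳ u φ = trans (cong (eval (φ ∘ genWords)) (⋆-identityʳ u)) (eval-⟦⟧ (φ ∘ genWords) u)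

star-[]ˡ : ∀ v φ → star [] v φ ≡ φ (genWords (reverse v))
star-[]ˡ v φ = eval-⟦⟧ (φ ∘ genWords) (reverse v)

star-z₂ˡ : ∀ u v φ → star (u ∷ʳ z₂) v φ ≡ star u v (φ ▹ z 2)
star-z₂ˡ u v φ = trans (cong (eval (φ ∘ genWords)) (⋆-z₂ˡ u (reverse v)))
  (eval-genWords-* φ (u ⋆ʷ reverse v) [ z₂ ])

star-z₂ʳ : ∀ u v φ → star u (z₂ ∷ v) φ ≡ star u v (φ ▹ z 2)
star-z₂ʳ u v φ = begin
  eval (φ ∘ genWords) (u ⋆ʷ reverse (z₂ ∷ v))  ≡⟨ cong (λ w → eval (φ ∘ genWords) (u ⋆ʷ w)) (List.unfold-reverse z₂ v) ⟩
  eval (φ ∘ genWords) (u ⋆ʷ (reverse v ∷ʳ z₂)) ≡⟨ cong (eval (φ ∘ genWords)) (⋆-z₂ʳ u (reverse v)) ⟩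
  eval (φ ∘ genWords) ((u ⋆ʷ reverse v) * ⟦ [ z₂ ] ⟧)  ≡⟨ eval-genWords-* φ (u ⋆ʷ reverse v) [ z₂ ] ⟩
  star u v (φ ▹ z 2) ∎

star-z₃ : ∀ u v φ → star (u ∷ʳ z₃) (z₃ ∷ v) φ ≡
  star u (z₃ ∷ v) (φ ▹ z 3) ℤ.+ star (u ∷ʳ z₃) v (φ ▹ z 3) ℤ.+ star u v (φ ▹ (z 2 ++ z 2 ++ z 2))
star-z₃ u v φ rewrite List.unfold-reverse z₃ v | ⋆-z₃ u (reverse v) = trans
  (eval-+ (φ ∘ genWords) (p₁ * ⟦ [ z₃ ] ⟧ + p₂ * ⟦ [ z₃ ] ⟧) (p₃ * ⟦ z₂ ∷ z₂ ∷ z₂ ∷ [] ⟧))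
  (cong₂ ℤ._+_ (trans (eval-+ (φ ∘ genWords) (p₁ * ⟦ [ z₃ ] ⟧) (p₂ * ⟦ [ z₃ ] ⟧))
      (cong₂ ℤ._+_ (eval-genWords-* φ p₁ [ z₃ ]) (eval-genWords-* φ p₂ [ z₃ ])))
    (eval-genWords-* φ p₃ (z₂ ∷ z₂ ∷ z₂ ∷ [])))
  where
  p₁ = u ⋆ʷ (reverse v ∷ʳ z₃)
  p₂ = (u ∷ʳ z₃) ⋆ʷ reverse v
  p₃ = u ⋆ʷ reverse v

-- Comparison of the eo-sum and the oe-sum

module _ (φ : Word → ℤ) where

  -- The variable t is realised on the right of the product, by t^k ↦ x^k and t^k ↦ z_k. The cutoff
  -- in `starZ` is that of the recursion, whereas `starX` retains k = 0, from which `w₁ ⋆ w₂` will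
  -- emerge.
  starX starZ : Word²Fun
  starX u v k = star u v (φ ▹ replicate k x)
  starZ u v k = star u v (φ ▹ z k) if 2 ≤ k

  starX-z₂ˡ : ∀ u v k → starX (u ∷ʳ z₂) v k ≡ starZ u v (2 ℕ.+ k)
  starX-z₂ˡ u v k = trans (star-z₂ˡ u v (φ ▹ replicate k x))
    (star-cong u v λ w → cong φ (List.++-assoc w (z 2) (replicate k x)))

  starX-z₂ʳ : ∀ u v k → starX u (z₂ ∷ v) k ≡ starZ u v (2 ℕ.+ k)
  starX-z₂ʳ u v k = trans (star-z₂ʳ u v (φ ▹ replicate k x))
    (star-cong u v λ w → cong φ (List.++-assoc w (z 2) (replicate k x)))

  -- In `z₂³ x^k` the last factor merges with x^k to z_{k+2}, and the other two are absorbed as a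
  -- final `z₂` of each word. This puts the rule for two letters `z₃` into the terms that occur at
  -- the junction.
  starX-z₃ : ∀ u v k → starX (u ∷ʳ z₃) (z₃ ∷ v) k ≡
    starZ u (z₃ ∷ v) (3 ℕ.+ k) ℤ.+ starZ (u ∷ʳ z₃) v (3 ℕ.+ k) ℤ.+ starZ (u ∷ʳ z₂) (z₂ ∷ v) (2 ℕ.+ k)
  starX-z₃ u v k = trans (star-z₃ u v φₖ) (cong₂ ℤ._+_
    (cong₂ ℤ._+_ (star-cong u (z₃ ∷ v) assoc₃) (star-cong (u ∷ʳ z₃) v assoc₃))
    (sym (trans (star-z₂ˡ u (z₂ ∷ v) (φ ▹ z (2 ℕ.+ k))) (trans (star-z₂ʳ u v (φ ▹ z (2 ℕ.+ k) ▹ z 2))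
      (star-cong u v λ w → cong φ (assoc₂₂₂ w))))))
    where
    φₖ = φ ▹ replicate k x
    assoc₃ : ∀ w → (φₖ ▹ z 3) w ≡ (φ ▹ z (3 ℕ.+ k)) w
    assoc₃ w = cong φ (List.++-assoc w (z 3) (replicate k x))
    assoc₂₂₂ : ∀ w → ((w ++ z 2) ++ z 2) ++ z (2 ℕ.+ k) ≡ (w ++ z 2 ++ z 2 ++ z 2) ++ replicate k x
    assoc₂₂₂ w = trans (List.++-assoc (w ++ z 2) (z 2) _) (trans (List.++-assoc w (z 2) _)
      (sym (List.++-assoc w (z 2 ++ z 2 ++ z 2) (replicate k x))))

  -- As words, `z₃ x^k` and `z₂ x^(k+1)` coincide. So a last factor `z₃ - t z₂` is sent to zero by
  -- t^k ↦ x^k when the other word is empty.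
  starX-last : ∀ u k → starX (u ∷ʳ z₃) [] k ≡ starX (u ∷ʳ z₂) [] (suc k)
  starX-last u k = trans (star-[]ʳ (u ∷ʳ z₃) (φ ▹ replicate k x)) (trans (cong φ (shift u))
    (sym (star-[]ʳ (u ∷ʳ z₂) (φ ▹ replicate (suc k) x))))
    where
    shift : ∀ u → genWords (u ∷ʳ z₃) ++ replicate k x ≡ genWords (u ∷ʳ z₂) ++ replicate (suc k) x
    shift u = trans (cong (_++ replicate k x) (genWords-++ u [ z₃ ]))
      (trans (List.++-assoc (genWords u) (z 3) (replicate k x))
      (sym (trans (cong (_++ replicate (suc k) x) (genWords-++ u [ z₂ ]))
        (List.++-assoc (genWords u) (z 2) (replicate (suc k) x)))))

  starX-first : ∀ v k → starX [] (z₃ ∷ v) k ≡ starX [] (z₂ ∷ v) (suc k)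
  starX-first v k = begin
    starX [] (z₃ ∷ v) k               ≡⟨ flip z₃ k ⟩
    starX (reverse v ∷ʳ z₃) [] k      ≡⟨ starX-last (reverse v) k ⟩
    starX (reverse v ∷ʳ z₂) [] (suc k) ≡⟨ flip z₂ (suc k) ⟨
    starX [] (z₂ ∷ v) (suc k)         ∎
    where
    flip : ∀ b k → starX [] (b ∷ v) k ≡ starX (reverse v ∷ʳ b) [] k
    flip b k = trans (star-[]ˡ (b ∷ v) (φ ▹ replicate k x))
      (trans (cong (λ w → φ (genWords w ++ replicate k x)) (List.unfold-reverse b v))
        (sym (star-[]ʳ (reverse v ∷ʳ b) (φ ▹ replicate k x))))

  -- With t^k ↦ z_k, the oe-terms minus the eo-terms are the eo-terms with t^k ↦ x^k.
  key-seam : ∀ a b u v k → appendδ a (λ u → prependδ b (starZ u) v) u k ≡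
    seamδ a b starZ u v k ℤ.+ seamδ a b starX u v k
  key-seam z₂ z₂ u v k = cong (λ t → starZ (u ∷ʳ z₂) (z₂ ∷ v) k ℤ.+ starZ (u ∷ʳ z₂) v (2 ℕ.+ k) ℤ.+ t)
    (sym (cong₂ ℤ._+_ (starX-z₂ˡ u (z₂ ∷ v) k) (starX-z₂ˡ u v (2 ℕ.+ k))))
  key-seam z₂ z₃ u v k = cong (λ t → starZ (u ∷ʳ z₂) (z₃ ∷ v) k ℤ.- starZ (u ∷ʳ z₂) (z₂ ∷ v) (suc k) ℤ.+ t)
    (sym (cong₂ ℤ._-_ (starX-z₂ˡ u (z₃ ∷ v) k) (starX-z₂ˡ u (z₂ ∷ v) (suc k))))
  key-seam z₃ z₂ u v k = trans
    (interchange-- (starZ (u ∷ʳ z₃) (z₂ ∷ v) k) (starZ (u ∷ʳ z₃) v (2 ℕ.+ k))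
      (starZ (u ∷ʳ z₂) (z₂ ∷ v) (suc k)) (starZ (u ∷ʳ z₂) v (3 ℕ.+ k)))
    (cong (λ t → starZ (u ∷ʳ z₃) (z₂ ∷ v) k ℤ.- starZ (u ∷ʳ z₂) (z₂ ∷ v) (suc k) ℤ.+ t)
      (sym (cong₂ ℤ._-_ (starX-z₂ʳ (u ∷ʳ z₃) v k) (starX-z₂ʳ (u ∷ʳ z₂) v (suc k)))))
  -- The oe-side has one extra term, in which both letters are lowered. On the other side it is
  -- supplied by the `z₂³` part of the rule for `⋆`; the two `z₃` parts cancel against the terms
  -- with one letter lowered.
  key-seam z₃ z₃ u v k = trans
    (rearrange (starZ (u ∷ʳ z₃) (z₃ ∷ v) k) (starZ (u ∷ʳ z₃) (z₂ ∷ v) (suc k)) (starZ (u ∷ʳ z₂) (z₃ ∷ v) (suc k))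
      (starZ (u ∷ʳ z₂) (z₂ ∷ v) (2 ℕ.+ k)) (starZ u (z₃ ∷ v) (3 ℕ.+ k)) (starZ (u ∷ʳ z₃) v (3 ℕ.+ k)))
    (cong (λ t → seamδ z₃ z₃ starZ u v k ℤ.+ t) (sym (cong₂ ℤ._+_ (starX-z₃ u v k)
      (cong₂ (λ s t → ℤ.- s ℤ.- t) (starX-z₂ʳ (u ∷ʳ z₃) v (suc k)) (starX-z₂ˡ u (z₃ ∷ v) (suc k))))))
    where
    rearrange : ∀ a b c d e f → a ℤ.- b ℤ.- (c ℤ.- d) ≡
      a ℤ.+ (ℤ.- b ℤ.- c) ℤ.+ (e ℤ.+ f ℤ.+ d ℤ.+ (ℤ.- f ℤ.- e))
    rearrange = solve-∀

  +-cancelled : ∀ s {t t′} → t ≡ t′ → s ≡ s ℤ.+ (t ℤ.- t′)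
  +-cancelled s {t} refl = sym (trans (cong (λ r → s ℤ.+ r) (ℤ.+-inverseʳ t)) (ℤ.+-identityʳ s))

  key-last : ∀ a u k → appendδ a (λ u → starZ u []) u k ≡
    lastδ a (λ u → starZ u []) u k ℤ.+ lastδ a (λ u → starX u []) u k
  key-last z₂ u k = cong (λ t → starZ (u ∷ʳ z₂) [] k ℤ.+ t) (sym (starX-z₂ˡ u [] k))
  key-last z₃ u k = +-cancelled (starZ (u ∷ʳ z₃) [] k ℤ.- starZ (u ∷ʳ z₂) [] (suc k)) (starX-last u k)

  key-first : ∀ b v k → prependδ b (starZ []) v k ≡ firstδ b (starZ []) v k ℤ.+ firstδ b (starX []) v k
  key-first z₂ v k = cong (λ t → starZ [] (z₂ ∷ v) k ℤ.+ t) (sym (starX-z₂ʳ [] v k))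
  key-first z₃ v k = +-cancelled (starZ [] (z₃ ∷ v) k ℤ.- starZ [] (z₂ ∷ v) (suc k)) (starX-first v k)

-- Homogeneity, additivity and constant terms at the junction

size-z₂ʳ : ∀ u m → size (u ∷ʳ z₂) ℕ.+ suc m ≡ size (u ∷ʳ z₃) ℕ.+ m
size-z₂ʳ u m rewrite size-∷ʳ u z₂ | size-∷ʳ u z₃ = cong (2 ℕ.+_) (ℕ.+-suc (size u) m)

lastδ-cong : ∀ a u k {g g′} → (∀ u′ k′ → size u′ ℕ.+ k′ ≡ size (u ∷ʳ a) ℕ.+ k → g u′ k′ ≡ g′ u′ k′) →
             lastδ a g u k ≡ lastδ a g′ u k
lastδ-cong z₂ u k h = h (u ∷ʳ z₂) k refl
lastδ-cong z₃ u k h = cong₂ ℤ._-_ (h (u ∷ʳ z₃) k refl) (h (u ∷ʳ z₂) (suc k) (size-z₂ʳ u k))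

firstδ-cong : ∀ b v k {g g′} → (∀ v′ k′ → size v′ ℕ.+ k′ ≡ size (b ∷ v) ℕ.+ k → g v′ k′ ≡ g′ v′ k′) →
              firstδ b g v k ≡ firstδ b g′ v k
firstδ-cong z₂ v k h = h (z₂ ∷ v) k refl
firstδ-cong z₃ v k h = cong₂ ℤ._-_ (h (z₃ ∷ v) k refl)
  (h (z₂ ∷ v) (suc k) (cong (2 ℕ.+_) (ℕ.+-suc (size v) k)))

seamδ-cong : ∀ a b u v k {G G′ : Word²Fun} →
  (∀ u′ v′ k′ → size u′ ℕ.+ (size v′ ℕ.+ k′) ≡ size (u ∷ʳ a) ℕ.+ (size (b ∷ v) ℕ.+ k) → G u′ v′ k′ ≡ G′ u′ v′ k′) →
  seamδ a b G u v k ≡ seamδ a b G′ u v k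
seamδ-cong a b u v k {G} {G′} h = cases a b h
  where
  decˡ : ∀ m → size (u ∷ʳ z₂) ℕ.+ (m ℕ.+ suc k) ≡ size (u ∷ʳ z₃) ℕ.+ (m ℕ.+ k)
  decˡ m = trans (cong (size (u ∷ʳ z₂) ℕ.+_) (ℕ.+-suc m k)) (size-z₂ʳ u (m ℕ.+ k))
  decʳ : ∀ m → m ℕ.+ (size (z₂ ∷ v) ℕ.+ suc k) ≡ m ℕ.+ (size (z₃ ∷ v) ℕ.+ k)
  decʳ m = cong (λ n → m ℕ.+ (2 ℕ.+ n)) (ℕ.+-suc (size v) k)
  cases : ∀ a b →
    (∀ u′ v′ k′ → size u′ ℕ.+ (size v′ ℕ.+ k′) ≡ size (u ∷ʳ a) ℕ.+ (size (b ∷ v) ℕ.+ k) → G u′ v′ k′ ≡ G′ u′ v′ k′) →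
    seamδ a b G u v k ≡ seamδ a b G′ u v k
  cases z₂ z₂ h = cong₂ ℤ._+_ (h (u ∷ʳ z₂) (z₂ ∷ v) k refl)
    (h (u ∷ʳ z₂) v (2 ℕ.+ k) (cong (size (u ∷ʳ z₂) ℕ.+_) (+-left-comm (size v) 2 k)))
  cases z₂ z₃ h = cong₂ ℤ._-_ (h (u ∷ʳ z₂) (z₃ ∷ v) k refl) (h (u ∷ʳ z₂) (z₂ ∷ v) (suc k) (decʳ (size (u ∷ʳ z₂))))
  cases z₃ z₂ h = cong₂ ℤ._-_ (h (u ∷ʳ z₃) (z₂ ∷ v) k refl) (h (u ∷ʳ z₂) (z₂ ∷ v) (suc k) (decˡ (size (z₂ ∷ v))))
  cases z₃ z₃ h = cong₂ ℤ._+_ (h (u ∷ʳ z₃) (z₃ ∷ v) k refl) (cong₂ (λ s t → ℤ.- s ℤ.- t)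
    (h (u ∷ʳ z₃) (z₂ ∷ v) (suc k) (decʳ (size (u ∷ʳ z₃)))) (h (u ∷ʳ z₂) (z₃ ∷ v) (suc k) (decˡ (size (z₃ ∷ v)))))

lastδ-+ : ∀ a g g′ u k → lastδ a (λ u k → g u k ℤ.+ g′ u k) u k ≡ lastδ a g u k ℤ.+ lastδ a g′ u k
lastδ-+ z₂ g g′ u k = refl
lastδ-+ z₃ g g′ u k = interchange-- (g (u ∷ʳ z₃) k) (g′ (u ∷ʳ z₃) k) (g (u ∷ʳ z₂) (suc k)) (g′ (u ∷ʳ z₂) (suc k))

firstδ-+ : ∀ b g g′ v k → firstδ b (λ v k → g v k ℤ.+ g′ v k) v k ≡ firstδ b g v k ℤ.+ firstδ b g′ v k
firstδ-+ z₂ g g′ v k = refl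
firstδ-+ z₃ g g′ v k = interchange-- (g (z₃ ∷ v) k) (g′ (z₃ ∷ v) k) (g (z₂ ∷ v) (suc k)) (g′ (z₂ ∷ v) (suc k))

seamδ-+ : ∀ a b (G G′ : Word²Fun) u v k → seamδ a b (λ u v k → G u v k ℤ.+ G′ u v k) u v k ≡
          seamδ a b G u v k ℤ.+ seamδ a b G′ u v k
seamδ-+ z₂ z₂ G G′ u v k = interchange (G (u ∷ʳ z₂) (z₂ ∷ v) k) (G′ (u ∷ʳ z₂) (z₂ ∷ v) k)
  (G (u ∷ʳ z₂) v (2 ℕ.+ k)) (G′ (u ∷ʳ z₂) v (2 ℕ.+ k))
seamδ-+ z₂ z₃ G G′ u v k = interchange-- (G (u ∷ʳ z₂) (z₃ ∷ v) k) (G′ (u ∷ʳ z₂) (z₃ ∷ v) k)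
  (G (u ∷ʳ z₂) (z₂ ∷ v) (suc k)) (G′ (u ∷ʳ z₂) (z₂ ∷ v) (suc k))
seamδ-+ z₃ z₂ G G′ u v k = interchange-- (G (u ∷ʳ z₃) (z₂ ∷ v) k) (G′ (u ∷ʳ z₃) (z₂ ∷ v) k)
  (G (u ∷ʳ z₂) (z₂ ∷ v) (suc k)) (G′ (u ∷ʳ z₂) (z₂ ∷ v) (suc k))
seamδ-+ z₃ z₃ G G′ u v k = rearrange (G (u ∷ʳ z₃) (z₃ ∷ v) k) (G′ (u ∷ʳ z₃) (z₃ ∷ v) k)
  (G (u ∷ʳ z₃) (z₂ ∷ v) (suc k)) (G′ (u ∷ʳ z₃) (z₂ ∷ v) (suc k))
  (G (u ∷ʳ z₂) (z₃ ∷ v) (suc k)) (G′ (u ∷ʳ z₂) (z₃ ∷ v) (suc k))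
  where
  rearrange : ∀ a a′ b b′ c c′ → a ℤ.+ a′ ℤ.+ (ℤ.- (b ℤ.+ b′) ℤ.- (c ℤ.+ c′)) ≡
    a ℤ.+ (ℤ.- b ℤ.- c) ℤ.+ (a′ ℤ.+ (ℤ.- b′ ℤ.- c′))
  rearrange = solve-∀

module _ {g : List Gen → ℕ → ℤ} (h : ∀ u k → g u (suc k) ≡ 0ℤ) where

  lastδ-0 : ∀ a u → lastδ a g u 0 ≡ g (u ∷ʳ a) 0
  lastδ-0 z₂ u = refl
  lastδ-0 z₃ u = trans (cong (λ t → g (u ∷ʳ z₃) 0 ℤ.- t) (h (u ∷ʳ z₂) 0)) (ℤ.+-identityʳ _)

  lastδ-suc : ∀ a u k → lastδ a g u (suc k) ≡ 0ℤ
  lastδ-suc z₂ u k = h (u ∷ʳ z₂) k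
  lastδ-suc z₃ u k = cong₂ ℤ._-_ (h (u ∷ʳ z₃) k) (h (u ∷ʳ z₂) (suc k))

  firstδ-0 : ∀ b v → firstδ b g v 0 ≡ g (b ∷ v) 0
  firstδ-0 z₂ v = refl
  firstδ-0 z₃ v = trans (cong (λ t → g (z₃ ∷ v) 0 ℤ.- t) (h (z₂ ∷ v) 0)) (ℤ.+-identityʳ _)

  firstδ-suc : ∀ b v k → firstδ b g v (suc k) ≡ 0ℤ
  firstδ-suc z₂ v k = h (z₂ ∷ v) k
  firstδ-suc z₃ v k = cong₂ ℤ._-_ (h (z₃ ∷ v) k) (h (z₂ ∷ v) (suc k))

module _ {G : Word²Fun} (h : ∀ u v k → G u v (suc k) ≡ 0ℤ) where

  seamδ-0 : ∀ a b u v → seamδ a b G u v 0 ≡ G (u ∷ʳ a) (b ∷ v) 0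
  seamδ-0 z₂ z₂ u v = trans (cong (λ t → G (u ∷ʳ z₂) (z₂ ∷ v) 0 ℤ.+ t) (h (u ∷ʳ z₂) v 1)) (ℤ.+-identityʳ _)
  seamδ-0 z₂ z₃ u v = trans (cong (λ t → G (u ∷ʳ z₂) (z₃ ∷ v) 0 ℤ.- t) (h (u ∷ʳ z₂) (z₂ ∷ v) 0)) (ℤ.+-identityʳ _)
  seamδ-0 z₃ z₂ u v = trans (cong (λ t → G (u ∷ʳ z₃) (z₂ ∷ v) 0 ℤ.- t) (h (u ∷ʳ z₂) (z₂ ∷ v) 0)) (ℤ.+-identityʳ _)
  seamδ-0 z₃ z₃ u v = trans (cong₂ (λ s t → G (u ∷ʳ z₃) (z₃ ∷ v) 0 ℤ.+ (ℤ.- s ℤ.- t))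
    (h (u ∷ʳ z₃) (z₂ ∷ v) 0) (h (u ∷ʳ z₂) (z₃ ∷ v) 0)) (ℤ.+-identityʳ _)

  seamδ-suc : ∀ a b u v k → seamδ a b G u v (suc k) ≡ 0ℤ
  seamδ-suc z₂ z₂ u v k = cong₂ ℤ._+_ (h (u ∷ʳ z₂) (z₂ ∷ v) k) (h (u ∷ʳ z₂) v (2 ℕ.+ k))
  seamδ-suc z₂ z₃ u v k = cong₂ ℤ._-_ (h (u ∷ʳ z₂) (z₃ ∷ v) k) (h (u ∷ʳ z₂) (z₂ ∷ v) (suc k))
  seamδ-suc z₃ z₂ u v k = cong₂ ℤ._-_ (h (u ∷ʳ z₃) (z₂ ∷ v) k) (h (u ∷ʳ z₂) (z₂ ∷ v) (suc k))
  seamδ-suc z₃ z₃ u v k = cong₂ ℤ._+_ (h (u ∷ʳ z₃) (z₃ ∷ v) k)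
    (cong₂ (λ s t → ℤ.- s ℤ.- t) (h (u ∷ʳ z₃) (z₂ ∷ v) (suc k)) (h (u ∷ʳ z₂) (z₃ ∷ v) (suc k)))

-- The induction

-- The eo-sum over code u v takes different forms according to which of u and v
-- are empty; these are the properties common to all of them.
record EoForm (u v : List Gen) : Set where
  field
    code≢[]  : code u v ≢ []
    E        : Word²Fun → ℤ
    eoSum≡E  : ∀ h → eoSum (code u v) h ≡ E (λ u′ v′ → h (code u′ v′))
    E-cong   : ∀ {G G′} →
      (∀ u′ v′ k → size u′ ℕ.+ (size v′ ℕ.+ k) ≡ size u ℕ.+ size v → G u′ v′ k ≡ G′ u′ v′ k) → E G ≡ E G′
    E-+      : ∀ G G′ → E (λ u′ v′ k → G u′ v′ k ℤ.+ G′ u′ v′ k) ≡ E G ℤ.+ E G′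
    E-const  : ∀ {G} → (∀ u′ v′ k → G u′ v′ (suc k) ≡ 0ℤ) → E G ≡ G u v 0
    key      : ∀ φ → δδSum u v (starZ φ) ≡ E (starZ φ) ℤ.+ E (starX φ)

codeˡ-∷ʳ≢[] : ∀ u a c → codeˡ (u ∷ʳ a) ++ c ≢ []
codeˡ-∷ʳ≢[] u a c eq with () ← trans (sym (codeˡ-∷ʳ u a c)) eq

seamForm : ∀ u a b v → EoForm (u ∷ʳ a) (b ∷ v)
seamForm u a b v = record
  { code≢[] = codeˡ-∷ʳ≢[] u a (codeʳ (b ∷ v))
  ; E       = λ G → δδSum u v (seamδ a b G)
  ; eoSum≡E = λ h → eoSum-seam h u a b v
  ; E-cong  = λ h → δδSum-cong u v λ u′ v′ k e → seamδ-cong a b u′ v′ k λ u″ v″ k″ e″ →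
      h u″ v″ k″ (trans e″ (sizes u′ v′ k e))
  ; E-+     = λ G G′ → trans (δδSum-ext u v (seamδ-+ a b G G′)) (δδSum-+ u v (seamδ a b G) (seamδ a b G′))
  ; E-const = λ {G} h → trans (δδSum-const u v {seamδ a b G} (seamδ-suc {G} h a b)) (seamδ-0 {G} h a b u v)
  ; key     = λ φ → trans (δδSum-ends u a b v (starZ φ)) (trans (δδSum-ext u v (key-seam φ a b))
      (δδSum-+ u v (seamδ a b (starZ φ)) (seamδ a b (starX φ))))
  }
  where
  regroup : ∀ a b k m n → a ℕ.+ m ℕ.+ (b ℕ.+ n ℕ.+ k) ≡ a ℕ.+ b ℕ.+ (m ℕ.+ (n ℕ.+ k))
  regroup = ℕ-solve
  regroup′ : ∀ a b m n → a ℕ.+ b ℕ.+ (m ℕ.+ n) ≡ a ℕ.+ m ℕ.+ (b ℕ.+ n)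
  regroup′ = ℕ-solve
  sizes : ∀ u′ v′ k → size u′ ℕ.+ (size v′ ℕ.+ k) ≡ size u ℕ.+ size v →
          size (u′ ∷ʳ a) ℕ.+ (size (b ∷ v′) ℕ.+ k) ≡ size (u ∷ʳ a) ℕ.+ size (b ∷ v)
  sizes u′ v′ k e rewrite size-∷ʳ u′ a | size-∷ʳ u a =
    trans (regroup (suc (exponent a)) (suc (exponent b)) k (size u′) (size v′))
      (trans (cong (suc (exponent a) ℕ.+ suc (exponent b) ℕ.+_) e)
        (regroup′ (suc (exponent a)) (suc (exponent b)) (size u) (size v)))

lastForm : ∀ u a → EoForm (u ∷ʳ a) []
lastForm u a = record
  { code≢[] = codeˡ-∷ʳ≢[] u a []
  ; E       = λ G → δSum u (lastδ a λ u′ → G u′ [])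
  ; eoSum≡E = λ h → eoSum-last h u a
  ; E-cong  = λ h → δSum-cong u λ u′ k e → lastδ-cong a u′ k λ u″ k″ e″ →
      h u″ [] k″ (trans e″ (sizes u′ k e))
  ; E-+     = λ G G′ → trans (δSum-ext u (lastδ-+ a (λ u → G u []) (λ u → G′ u []))) (δSum-+ u _ _)
  ; E-const = λ h → trans (δSum-const u (lastδ-suc (λ u → h u []) a)) (lastδ-0 (λ u → h u []) a u)
  ; key     = λ φ → trans (δSum-ext (u ∷ʳ a) λ u′ k → cong (starZ φ u′ []) (ℕ.+-identityʳ k))
      (trans (δSum-∷ʳ u a _) (trans (δSum-ext u (key-last φ a)) (δSum-+ u _ _)))
  }
  where
  sizes : ∀ u′ k → size u′ ℕ.+ k ≡ size u → size (u′ ∷ʳ a) ℕ.+ k ≡ size (u ∷ʳ a) ℕ.+ 0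
  sizes u′ k e rewrite size-∷ʳ u′ a | size-∷ʳ u a = trans (ℕ.+-assoc (suc (exponent a)) (size u′) k)
    (trans (cong (suc (exponent a) ℕ.+_) e) (sym (ℕ.+-identityʳ _)))

firstForm : ∀ b v → EoForm [] (b ∷ v)
firstForm b v = record
  { code≢[] = λ ()
  ; E       = λ G → δSum v (firstδ b (G []))
  ; eoSum≡E = λ h → eoSum-first h b v
  ; E-cong  = λ h → δSum-cong v λ v′ k e → firstδ-cong b v′ k λ v″ k″ e″ →
      h [] v″ k″ (trans e″ (trans (ℕ.+-assoc (suc (exponent b)) (size v′) k) (cong (suc (exponent b) ℕ.+_) e)))
  ; E-+     = λ G G′ → trans (δSum-ext v (firstδ-+ b (G []) (G′ []))) (δSum-+ v _ _)
  ; E-const = λ h → trans (δSum-const v (firstδ-suc (h []) b)) (firstδ-0 (h []) b v)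
  ; key     = λ φ → trans (δSum-∷ b v _) (trans (δSum-ext v (key-first φ b)) (δSum-+ v _ _))
  }

eoForm : ∀ u v → u ≢ [] ⊎ v ≢ [] → EoForm u v
eoForm u v ne with List.initLast u
eoForm _ (b ∷ v) ne | u ∷ʳ′ a = seamForm u a b v
eoForm _ []      ne | u ∷ʳ′ a = lastForm u a
eoForm _ (b ∷ v) ne | []      = firstForm b v
eoForm _ []      ne | []      = ⊥-elim (Sum.[ (λ h → h refl) , (λ h → h refl) ] ne)

𝔇-upTo-suc : ∀ n c → c ≢ [] → 𝔇-upTo (suc n) c ≡ step (𝔇-upTo n) c
𝔇-upTo-suc n []      c≢[] = ⊥-elim (c≢[] refl)
𝔇-upTo-suc n (_ ∷ _) _    = refl

-- Since the term k = 0 of the eo-sums is missing from the recursion, what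
-- remains after the cancellation of key is exactly this term.
eval-𝔇-step : ∀ n u v φ → size u ℕ.+ size v ≤ suc n → EoForm u v →
  (∀ u′ v′ ψ → size u′ ℕ.+ size v′ ≤ n → eval ψ (𝔇-upTo n (code u′ v′)) ≡ star u′ v′ ψ) →
  eval φ (𝔇-upTo (suc n) (code u v)) ≡ star u v φ
eval-𝔇-step n u v φ s≤ form ih = begin
  eval φ (𝔇-upTo (suc n) (code u v))
    ≡⟨ cong (eval φ) (𝔇-upTo-suc n (code u v) code≢[]) ⟩
  eval φ (step F (code u v))
    ≡⟨ eval-step φ F (code u v) ⟩
  ℤ.- eoSum (code u v) (xTerm φ F) ℤ.- eoSum (code u v) (zTerm φ F) ℤ.+ oeSum (code u v) (zTerm φ F)
    ≡⟨ cong₂ ℤ._+_ (cong₂ (λ s t → ℤ.- s ℤ.- t)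
         (trans (eoSum≡E (xTerm φ F)) (E-cong x-terms))
         (trans (eoSum≡E (zTerm φ F)) (E-cong z-terms)))
         (trans (oeSum-code u v (zTerm φ F)) (trans (δδSum-cong u v z-terms) (key φ))) ⟩
  ℤ.- E X⁺ ℤ.- E (starZ φ) ℤ.+ (E (starZ φ) ℤ.+ E (starX φ))
    ≡⟨ cong (λ t → ℤ.- E X⁺ ℤ.- E (starZ φ) ℤ.+ (E (starZ φ) ℤ.+ t)) split ⟩
  ℤ.- E X⁺ ℤ.- E (starZ φ) ℤ.+ (E (starZ φ) ℤ.+ (E X⁺ ℤ.+ starX φ u v 0))
    ≡⟨ cancel (E X⁺) (E (starZ φ)) (starX φ u v 0) ⟩
  starX φ u v 0
    ≡⟨ star-cong u v (λ w → cong φ (List.++-identityʳ w)) ⟩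
  star u v φ ∎
  where
  open EoForm form
  F = 𝔇-upTo n
  -- `X⁺` is the part of `starX` that the recursion contains; `X⁰` has no positive power of t, so
  -- `E-const` evaluates it at `u` and `v` themselves.
  X⁺ X⁰ : Word²Fun
  X⁺ u′ v′ k = starX φ u′ v′ k if 1 ≤ k
  X⁰ u′ v′ zero    = starX φ u′ v′ 0
  X⁰ u′ v′ (suc k) = 0ℤ
  smaller : ∀ u′ v′ k → size u′ ℕ.+ (size v′ ℕ.+ suc k) ≡ size u ℕ.+ size v → size u′ ℕ.+ size v′ ≤ n
  smaller u′ v′ k e = ℕ.≤-pred (ℕ.≤-trans (s≤s (ℕ.m≤m+n _ k)) (ℕ.≤-trans (ℕ.≤-reflexive
    (trans (regroup (size u′) (size v′) k) e)) s≤))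
    where
    regroup : ∀ a b k → suc (a ℕ.+ b ℕ.+ k) ≡ a ℕ.+ (b ℕ.+ suc k)
    regroup = ℕ-solve
  x-terms : ∀ u′ v′ k → size u′ ℕ.+ (size v′ ℕ.+ k) ≡ size u ℕ.+ size v → xTerm φ F (code u′ v′) k ≡ X⁺ u′ v′ k
  x-terms u′ v′ zero    e = refl
  x-terms u′ v′ (suc k) e = ih u′ v′ _ (smaller u′ v′ k e)
  z-terms : ∀ u′ v′ k → size u′ ℕ.+ (size v′ ℕ.+ k) ≡ size u ℕ.+ size v → zTerm φ F (code u′ v′) k ≡ starZ φ u′ v′ k
  z-terms u′ v′ zero          e = refl
  z-terms u′ v′ (suc zero)    e = refl
  z-terms u′ v′ (suc (suc k)) e = ih u′ v′ _ (smaller u′ v′ (suc k) e)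
  split : E (starX φ) ≡ E X⁺ ℤ.+ starX φ u v 0
  split = trans (E-cong λ { u′ v′ zero _ → sym (ℤ.+-identityˡ _) ; u′ v′ (suc k) _ → sym (ℤ.+-identityʳ _) })
    (trans (E-+ X⁺ X⁰) (cong (λ t → E X⁺ ℤ.+ t) (E-const λ _ _ _ → refl)))
  cancel : ∀ a b c → ℤ.- a ℤ.- b ℤ.+ (b ℤ.+ (a ℤ.+ c)) ≡ c
  cancel = solve-∀

eval-𝔇-upTo : ∀ n u v φ → size u ℕ.+ size v ≤ n → eval φ (𝔇-upTo n (code u v)) ≡ star u v φ
eval-𝔇-upTo n       []        []        φ _  = refl
eval-𝔇-upTo (suc n) u@(_ ∷ _) v         φ s≤ =
  eval-𝔇-step n u v φ s≤ (eoForm u v (inj₁ λ ())) (eval-𝔇-upTo n)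
eval-𝔇-upTo (suc n) []        v@(_ ∷ _) φ s≤ =
  eval-𝔇-step n [] v φ s≤ (eoForm [] v (inj₂ λ ())) (eval-𝔇-upTo n)

-- From exponent tuples to words and linear combinations

sum-code : ∀ u v → sum (code u v) ≡ size u ℕ.+ size v
sum-code (g ∷ u) v = cong suc (trans (cong (exponent g ℕ.+_) (sum-code u v)) (sym (ℕ.+-assoc (exponent g) (size u) _)))
sum-code []      v = sum-codeʳ v
  where
  sum-codeʳ : ∀ v → sum (codeʳ v) ≡ size v
  sum-codeʳ []      = refl
  sum-codeʳ (g ∷ v) = trans (ℕ.+-suc (exponent g) _) (cong (λ s → suc (exponent g ℕ.+ s)) (sum-codeʳ v))

exponent-positive : ∀ g → 1 ≤ exponent g
exponent-positive z₂ = s≤s z≤n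
exponent-positive z₃ = s≤s z≤n

code-positive : ∀ u v → Positive (code u v)
code-positive (g ∷ u) v       = s≤s z≤n ∷ exponent-positive g ∷ code-positive u v
code-positive []      []      = []
code-positive []      (g ∷ v) = exponent-positive g ∷ s≤s z≤n ∷ code-positive [] v

-- Each letter occupies two exponents, so every letter block starts again with y. The blocks of the
-- second word are `τ(z₂) = yx` and `τ(z₃) = yyx`, and the reversal in `τ` undoes the backward
-- reading of `v`.
powers-code : ∀ u v → powers y (code u v) ≡ genWords u ++ reverse (map swap (genWords (reverse v)))
powers-code (z₂ ∷ u) v  = cong (z 2 ++_) (powers-code u v)
powers-code (z₃ ∷ u) v  = cong (z 3 ++_) (powers-code u v)
powers-code []       [] = refl
powers-code []  (g ∷ v) = sym (begin
  reverse (map swap (genWords (reverse (g ∷ v))))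
    ≡⟨ cong (reverse ∘ map swap) (trans (cong genWords (List.unfold-reverse g v)) (genWords-++ (reverse v) [ g ])) ⟩
  reverse (map swap (genWords (reverse v) ++ genWords [ g ]))
    ≡⟨ cong reverse (List.map-++ swap (genWords (reverse v)) (genWords [ g ])) ⟩
  reverse (map swap (genWords (reverse v)) ++ map swap (genWords [ g ]))
    ≡⟨ List.reverse-++ (map swap (genWords (reverse v))) (map swap (genWords [ g ])) ⟩
  reverse (map swap (genWords [ g ])) ++ reverse (map swap (genWords (reverse v)))
    ≡⟨ cong (reverse (map swap (genWords [ g ])) ++_) (powers-code [] v) ⟨
  reverse (map swap (genWords [ g ])) ++ powers y (code [] v)
    ≡⟨ letter g ⟩
  powers y (code [] (g ∷ v)) ∎)
  where
  letter : ∀ g → reverse (map swap (genWords [ g ])) ++ powers y (code [] v) ≡ powers y (code [] (g ∷ v))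
  letter z₂ = refl
  letter z₃ = refl

exponents-code : ∀ u v → exponents (genWords u ++ reverse (map swap (genWords v))) ≡ code u (reverse v)
exponents-code u v = begin
  exponents (genWords u ++ reverse (map swap (genWords v)))
    ≡⟨ cong (λ w → exponents (genWords u ++ reverse (map swap (genWords w)))) (List.reverse-involutive v) ⟨
  exponents (genWords u ++ reverse (map swap (genWords (reverse (reverse v)))))
    ≡⟨ cong exponents (powers-code u (reverse v)) ⟨
  exponents (powers y (code u (reverse v)))
    ≡⟨ exponents-powers y (code u (reverse v)) (code-positive u (reverse v)) ⟩
  code u (reverse v) ∎

eval-𝔇-words : ∀ φ u v → eval φ (𝔇 (exponents (genWords u ++ reverse (map swap (genWords v))))) ≡
               eval (φ ∘ genWords) (u ⋆ʷ v)
eval-𝔇-words φ u v = begin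
  eval φ (𝔇 (exponents (genWords u ++ reverse (map swap (genWords v)))))
    ≡⟨ cong (eval φ ∘ 𝔇) (exponents-code u v) ⟩
  eval φ (𝔇 (code u (reverse v)))
    ≡⟨ eval-𝔇-upTo _ u (reverse v) φ (ℕ.≤-reflexive (sym (sum-code u (reverse v)))) ⟩
  eval (φ ∘ genWords) (u ⋆ʷ reverse (reverse v))
    ≡⟨ cong (λ w → eval (φ ∘ genWords) (u ⋆ʷ w)) (List.reverse-involutive v) ⟩
  eval (φ ∘ genWords) (u ⋆ʷ v) ∎

eval-ι : ∀ φ p → eval φ (ι p) ≡ eval (φ ∘ genWords) p
eval-ι φ p = trans (eval-linear φ (λ w → ⟦ genWords w ⟧) p) (eval-cong p λ w → eval-⟦⟧ φ (genWords w))

eval-τ : ∀ φ p → eval φ (τ p) ≡ eval (λ w → φ (reverse (map swap w))) p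
eval-τ φ p = trans (eval-linear φ (λ w → ⟦ reverse (map swap w) ⟧) p)
  (eval-cong p λ w → eval-⟦⟧ φ (reverse (map swap w)))

eval-⋆ : ∀ φ p q → eval φ (p ⋆ q) ≡ eval (λ u → eval (λ v → eval φ (u ⋆ʷ v)) q) p
eval-⋆ φ p q = trans (eval-linear φ (λ u → linear (λ v → u ⋆ʷ v) q) p)
  (eval-cong p λ u → eval-linear φ (λ v → u ⋆ʷ v) q)

theorem1p3 : (w₁ w₂ : ℋ²³) → proj₁ (𝒟 (ι w₁ * τ (ι w₂) , w₁τw₂∈ℋ⁰ w₁ w₂)) ≈ ι (w₁ ⋆ w₂)
theorem1p3 w₁ w₂ = ≈-by-eval {p = linear (𝔇 ∘ exponents) (ι w₁ * τ (ι w₂))} {q = ι (w₁ ⋆ w₂)} λ φ →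
  -- `Φ` is `φ` pulled back along 𝒟 to words. Both sides then expand bilinearly in `w₁` and `w₂`,
  -- which leaves the identity for a pair of words.
  let Φ = eval φ ∘ 𝔇 ∘ exponents in begin
  eval φ (linear (𝔇 ∘ exponents) (ι w₁ * τ (ι w₂)))
    ≡⟨ eval-linear φ (𝔇 ∘ exponents) (ι w₁ * τ (ι w₂)) ⟩
  eval Φ (ι w₁ * τ (ι w₂))
    ≡⟨ eval-* Φ (ι w₁) (τ (ι w₂)) ⟩
  eval (λ u → eval (λ v → Φ (u ++ v)) (τ (ι w₂))) (ι w₁)
    ≡⟨ eval-ι (λ u → eval (λ v → Φ (u ++ v)) (τ (ι w₂))) w₁ ⟩
  eval (λ u → eval (λ v → Φ (genWords u ++ v)) (τ (ι w₂))) w₁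
    ≡⟨ eval-cong w₁ (λ u → trans (eval-τ (λ v → Φ (genWords u ++ v)) (ι w₂))
         (trans (eval-ι (λ v → Φ (genWords u ++ reverse (map swap v))) w₂)
           (eval-cong w₂ λ v → eval-𝔇-words φ u v))) ⟩
  eval (λ u → eval (λ v → eval (φ ∘ genWords) (u ⋆ʷ v)) w₂) w₁
    ≡⟨ eval-⋆ (φ ∘ genWords) w₁ w₂ ⟨
  eval (φ ∘ genWords) (w₁ ⋆ w₂)
    ≡⟨ eval-ι φ (w₁ ⋆ w₂) ⟨
  eval φ (ι (w₁ ⋆ w₂)) ∎
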